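{- Let $q$ be a prime power, $n=tt'$ with integers $t,t'\ge2$, $\mathbf a=(a_0,\dots,a_{t'-1})\in\mathbb{F}_{q^n}^{t'}$ such that $g_{\mathbf a}(x)=\sum_{i=0}^{t'-1}a_ix^{q^{it}}$ is bijective on $\mathbb{F}_{q^n}$. Let $\gamma=q^j$ where $x\mapsto x^{q^j}$ generates $\mathrm{Gal}(\mathbb{F}_{q^t}/\mathbb{F}_q)$ (i.e. $\gcd(j,t)=1$), write $x^\gamma=x^{q^j}$, and let $k\in\mathbb{N}$. Then the code $\langle g_{\mathbf a}(x^\gamma),x^{q^{kt}}\rangle_{\mathbb{F}_{q^n}}=\{\alpha g_{\mathbf a}(x^\gamma)+\beta x^{q^{kt}}\colon \alpha,\beta\in\mathbb{F}_{q^n}\}$ is an $s$-almost MRD-code in $\mathbb{F}_q^{n\times n}$ for some $s\le n/t-1$.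
   Context: Each $\mathbb{F}_q$-linear map of $\mathbb{F}_{q^n}$ is identified (via an $\mathbb{F}_q$-basis) with a matrix in $\mathbb{F}_q^{n\times n}$; a rank metric code is an $\mathbb{F}_q$-subspace $\mathcal C$ of $\mathbb{F}_q^{\ell\times n}$ with distance $d(A,B)=\mathrm{rk}(A-B)$ and minimum distance $d=\min\{\mathrm{rk}(A-B)\colon A\ne B\in\mathcal C\}$. The Singleton-like bound states $\dim_{\mathbb{F}_q}\mathcal C\le\max\{\ell,n\}(\min\{\ell,n\}-d+1)$; let $d^*$ be the largest $d$ allowed by this bound for the given dimension. $\mathcal C$ is an $s$-almost MRD-code if its minimum distance equals $d^*-s$. -}

module Defs where

open import Level using (0ℓ)
open import Data.Nat as ℕ using (ℕ; zero; suc; _≤_)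
open import Data.Nat.Primality using (Prime)
open import Data.Fin using (Fin; zero; suc; toℕ)
open import Data.Product using (Σ; ∃; ∃-syntax; _×_; _,_)
open import Relation.Nullary using (¬_)
open import Relation.Binary.PropositionalEquality using (_≡_)
open import Algebra.Bundles using (CommutativeRing)

IsPrimePower : ℕ → Set
IsPrimePower q = ∃[ p ] ∃[ m ] (Prime p × 1 ≤ m × q ≡ p ℕ.^ m)

record Field : Set₁ where
  field
    commRing : CommutativeRing 0ℓ 0ℓ
  open CommutativeRing commRing public
  field
    0≉1     : ¬ (0# ≈ 1#)
    inverse : ∀ x → ¬ (x ≈ 0#) → ∃[ y ] (x * y ≈ 1#)

module FieldTheory (F : Field) where
  open Field F hiding (zero)

  infixr 8 _^_
  _^_ : Carrier → ℕ → Carrier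
  x ^ zero  = 1#
  x ^ suc m = x * (x ^ m)

  HasCard : ℕ → Set
  HasCard N = Σ (Fin N → Carrier) λ e →
                (∀ i j → e i ≈ e j → i ≡ j) × (∀ x → ∃[ i ] (e i ≈ x))

  InFq : ℕ → Carrier → Set
  InFq q x = x ^ q ≈ x

  ∑ : (r : ℕ) → (Fin r → Carrier) → Carrier
  ∑ zero    f = 0#
  ∑ (suc r) f = f zero + ∑ r (λ i → f (suc i))

  -- maps F → F  (F_q-linear maps of F_{q^n}), with pointwise equality
  Map : Set
  Map = Carrier → Carrier

  _≐_ : Map → Map → Set
  f ≐ g = ∀ x → f x ≈ g x

  _⊖_ : Map → Map → Map
  (f ⊖ g) x = f x - g x

  IndepElems : ℕ → (r : ℕ) → (Fin r → Carrier) → Set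
  IndepElems q r v = ∀ (c : Fin r → Carrier) → (∀ i → InFq q (c i)) →
                       ∑ r (λ i → c i * v i) ≈ 0# → ∀ i → c i ≈ 0#

  IndepMaps : ℕ → (r : ℕ) → (Fin r → Map) → Set
  IndepMaps q r h = ∀ (c : Fin r → Carrier) → (∀ i → InFq q (c i)) →
                      (∀ x → ∑ r (λ i → c i * h i x) ≈ 0#) → ∀ i → c i ≈ 0#

  InImage : Map → Carrier → Set
  InImage f y = ∃[ x ] (f x ≈ y)

  HasRank : ℕ → Map → ℕ → Set
  HasRank q f r =
    (∃[ v ] ((∀ i → InImage f (v i)) × IndepElems q r v)) ×
    (∀ (w : Fin (suc r) → Carrier) → (∀ i → InImage f (w i)) → ¬ IndepElems q (suc r) w)

  Code : Set₁
  Code = Map → Set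

  HasDim : ℕ → Code → ℕ → Set
  HasDim q C D =
    (∃[ h ] ((∀ i → C (h i)) × IndepMaps q D h)) ×
    (∀ (h : Fin (suc D) → Map) → (∀ i → C (h i)) → ¬ IndepMaps q (suc D) h)

  HasMinDist : ℕ → Code → ℕ → Set
  HasMinDist q C d =
    (∃[ A ] ∃[ B ] (C A × C B × ¬ (A ≐ B) × HasRank q (A ⊖ B) d)) ×
    (∀ A B → C A → C B → ¬ (A ≐ B) → ∀ r → HasRank q (A ⊖ B) r → d ≤ r)

  -- d* = largest d (1 ≤ d ≤ min{ℓ,n} = n) with D ≤ n (n - d + 1)  (square case ℓ = n);
  -- C is s-almost MRD iff d = d* - s.
  IsDStar : ℕ → ℕ → ℕ → Set
  IsDStar n D d* = (1 ≤ d* × d* ≤ n × D ≤ n ℕ.* (n ℕ.∸ d* ℕ.+ 1)) ×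
                   (∀ e → 1 ≤ e → e ≤ n → D ≤ n ℕ.* (n ℕ.∸ e ℕ.+ 1) → e ≤ d*)

  IsAlmostMRD : ℕ → ℕ → Code → ℕ → Set
  IsAlmostMRD q n C s = ∃[ D ] ∃[ d ] ∃[ d* ]
    (HasDim q C D × HasMinDist q C d × IsDStar n D d* × d* ≡ d ℕ.+ s)

  gA : ℕ → ℕ → (t' : ℕ) → (Fin t' → Carrier) → Map
  gA q t t' a x = ∑ t' (λ i → a i * x ^ (q ℕ.^ (toℕ i ℕ.* t)))

  Bijective : Map → Set
  Bijective f = (∀ x y → f x ≈ f y → x ≈ y) × (∀ y → ∃[ x ] (f x ≈ y))

  theCode : ℕ → ℕ → (t' : ℕ) → (Fin t' → Carrier) → ℕ → ℕ → Code
  theCode q t t' a j k h = ∃[ α ] ∃[ β ]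
    (∀ x → h x ≈ α * gA q t t' a (x ^ (q ℕ.^ j)) + β * x ^ (q ℕ.^ (k ℕ.* t)))

{-# OPTIONS --safe #-}
module Submission where

-- Write K = 𝔽_{q^t}.  If x₁, …, x_r are 𝔽_q-independent zeros of α g(x^γ) + β x^{q^{kt}} with
-- β ≠ 0, they are K-independent: in a relation Σ λᵢ xᵢ = 0 over K normalised to λ₁ = 1, applying
-- x ↦ g(x^γ) and x ↦ x^{q^{kt}} gives the shorter relation Σ (λᵢ^γ − λᵢ) xᵢ = 0, so by induction
-- every λᵢ is fixed by γ and hence lies in 𝔽_q.  Since dim_K 𝔽_{q^n} = t', the kernel of a non-zero
-- codeword has 𝔽_q-dimension at most t' and its rank is at least n − t'.  In particular a pair
-- (α, β) ≠ 0 never gives the zero map, so the code has dimension 2n and d* = n − 1, while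
-- g(x^γ) − g(1) x^{q^{kt}} kills 1, so the minimum distance is at most n − 1.

open import Defs
open import Data.Bool using (Bool; true; false)
open import Data.Fin as Fin using (Fin; zero; suc; toℕ; fromℕ; inject₁)
open import Data.Fin.Permutation using (Permutation; permutation; _⟨$⟩ʳ_)
import Data.Fin.Properties as Fin
open import Data.Nat as ℕ using (ℕ; zero; suc; z≤n; s≤s)
open import Data.Nat.Combinatorics using (_C_; nC1≡n; nCn≡1; nCk+nC[k+1]≡[n+1]C[k+1])
open import Data.Nat.Coprimality using (Coprime; coprime-Bézout)
open import Data.Nat.Divisibility using (_∣_; divides; ∣⇒≤; m∣m*n)
open import Data.Nat.GCD using (module Bézout)
open import Data.Nat.Primality using (Prime; euclidsLemma; prime⇒nonTrivial)
import Data.Nat.Properties as ℕ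
open import Data.Nat.Tactic.RingSolver using (solve-∀)
open import Data.Product using (Σ; ∃; ∃-syntax; _×_; _,_; proj₁; proj₂)
open import Data.Sum as Sum using (_⊎_; inj₁; inj₂; [_,_]; [_,_]′)
open import Data.Unit using (⊤; tt)
open import Function using (_∘_; id)
open import Relation.Binary.PropositionalEquality as ≡ using (_≡_; _≢_)
open import Relation.Nullary using (¬_; Dec; yes; no; contradiction)
open import Relation.Nullary.Decidable using (¬?; map′; _×-dec_; decidable-stable)
import Algebra.Properties.AbelianGroup
import Algebra.Properties.CommutativeMonoid.Sum
import Algebra.Properties.CommutativeSemigroup
import Algebra.Properties.CommutativeSemiring.Binomial
import Algebra.Properties.CommutativeSemiring.Exp
import Algebra.Properties.Monoid.Sum
import Algebra.Properties.Ring
import Algebra.Properties.Semiring.Exp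
import Algebra.Properties.Semiring.Mult
import Relation.Binary.Reasoning.Setoid

-- The subfields enter only as equations: `InFq Q` says x^Q = x. Dimension theory over it rests on
-- its having exactly Q solutions, for Q = q and Q = q^t. There are at most Q by counting roots, and
-- at least Q because the cofactor of x^Q - x in x^N - x, with N the order of the field, has degree
-- N - Q and vanishes at every other element. Dimensions are then compared through cardinalities: r
-- independent vectors have Q^r distinct combinations, a spanning family of length r reaches at most
-- Q^r elements, and q^a ≤ q^b yields a ≤ b. As the field is finite, independence, membership in an
-- image and the existence of a codeword of bounded rank are decidable, so maximal families and the
-- least rank come from a search. For β = 0 and α ≠ 0 the codeword is α g(x^γ), whose kernel is
-- trivial since g is injective. The strict inequality t′ < n, a consequence of t ≥ 2, is what keeps
-- a non-zero pair from giving the zero map.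

-- Divisibility of binomial coefficients by a prime.

[1+k]*[1+n]C[1+k] : ∀ n k → suc k ℕ.* (suc n C suc k) ≡ suc n ℕ.* (n C k)
[1+k]*[1+n]C[1+k] n zero = ≡.trans (ℕ.*-identityˡ _) (≡.trans (nC1≡n (suc n)) (≡.sym (ℕ.*-identityʳ _)))
[1+k]*[1+n]C[1+k] zero (suc k) = ℕ.*-zeroʳ (suc (suc k))
[1+k]*[1+n]C[1+k] (suc n) (suc k) = begin
  suc (suc k) ℕ.* (suc (suc n) C suc (suc k))
    ≡⟨ ≡.cong (suc (suc k) ℕ.*_) (nCk+nC[k+1]≡[n+1]C[k+1] (suc n) (suc k)) ⟨
  suc (suc k) ℕ.* ((suc n C suc k) ℕ.+ (suc n C suc (suc k)))
    ≡⟨ split (suc k) (suc n C suc k) _ ⟩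
  (suc n C suc k) ℕ.+ (suc k ℕ.* (suc n C suc k) ℕ.+ suc (suc k) ℕ.* (suc n C suc (suc k)))
    ≡⟨ ≡.cong ((suc n C suc k) ℕ.+_) (≡.cong₂ ℕ._+_ ([1+k]*[1+n]C[1+k] n k) ([1+k]*[1+n]C[1+k] n (suc k))) ⟩
  (suc n C suc k) ℕ.+ (suc n ℕ.* (n C k) ℕ.+ suc n ℕ.* (n C suc k))
    ≡⟨ ≡.cong ((suc n C suc k) ℕ.+_) (ℕ.*-distribˡ-+ (suc n) (n C k) (n C suc k)) ⟨
  (suc n C suc k) ℕ.+ suc n ℕ.* ((n C k) ℕ.+ (n C suc k))
    ≡⟨ ≡.cong (λ c → (suc n C suc k) ℕ.+ suc n ℕ.* c) (nCk+nC[k+1]≡[n+1]C[k+1] n k) ⟩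
  (suc n C suc k) ℕ.+ suc n ℕ.* (suc n C suc k) ∎
  where
  open ≡.≡-Reasoning
  split : ∀ a x y → suc a ℕ.* (x ℕ.+ y) ≡ x ℕ.+ (a ℕ.* x ℕ.+ suc a ℕ.* y)
  split = solve-∀

-- By the absorption identity the prime divides `suc k` times the coefficient; it is too large to
-- divide `suc k`, so Euclid's lemma leaves the coefficient.
prime∣pC[1+k] : ∀ {p} → Prime (suc p) → ∀ k → k ℕ.< p → suc p ∣ (suc p C suc k)
prime∣pC[1+k] {p} pr k k<p
  with euclidsLemma (suc k) (suc p C suc k) pr
         (≡.subst (suc p ∣_) (≡.sym ([1+k]*[1+n]C[1+k] p k)) (m∣m*n (p C k)))
... | inj₁ p∣k = contradiction (∣⇒≤ p∣k) (ℕ.<⇒≱ (s≤s k<p))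
... | inj₂ p∣C = p∣C

-- Field arithmetic, linear combinations and additive power maps.

module FieldProperties (F : Field) where
  open Field F hiding (zero)
  open FieldTheory F
  open Relation.Binary.Reasoning.Setoid setoid
  open Algebra.Properties.AbelianGroup +-abelianGroup public
    using () renaming (⁻¹-∙-comm to -‿+-comm; identityʳ-unique to +-identityʳ-unique; inverseʳ-unique to -‿unique; x∙y⁻¹≈ε⇒x≈y to x-y≈0⇒x≈y)
  open Algebra.Properties.Ring ring public using (-‿distribˡ-*; -‿distribʳ-*; -0#≈0#)
  private
    module E = Algebra.Properties.Semiring.Exp semiring
    module CE = Algebra.Properties.CommutativeSemiring.Exp commutativeSemiring
    module M = Algebra.Properties.Semiring.Mult semiring
    module S = Algebra.Properties.Monoid.Sum +-monoid
    module B = Algebra.Properties.CommutativeSemiring.Binomial commutativeSemiring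
    module CS = Algebra.Properties.CommutativeSemigroup +-commutativeSemigroup
    module *CS = Algebra.Properties.CommutativeSemigroup *-commutativeSemigroup

  ≡⇒≈ : ∀ {x y} → x ≡ y → x ≈ y
  ≡⇒≈ ≡.refl = refl

  x≈y⇒x-y≈0 : ∀ {x y} → x ≈ y → x - y ≈ 0#
  x≈y⇒x-y≈0 {x} {y} x≈y = trans (+-congʳ x≈y) (-‿inverseʳ y)

  *-distribˡ-- : ∀ x y z → x * (y - z) ≈ x * y - x * z
  *-distribˡ-- x y z = trans (distribˡ x y (- z)) (+-congˡ (sym (-‿distribʳ-* x z)))

  *-distribʳ-- : ∀ x y z → (y - z) * x ≈ y * x - z * x
  *-distribʳ-- x y z = trans (distribʳ x y (- z)) (+-congˡ (sym (-‿distribˡ-* z x)))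

  -‿+-interchange : ∀ w x y z → (w + x) - (y + z) ≈ (w - y) + (x - z)
  -‿+-interchange w x y z =
    trans (+-congˡ (sym (-‿+-comm y z))) (CS.interchange w x (- y) (- z))

  x*y≈0⇒y≈0 : ∀ {x y} → ¬ x ≈ 0# → x * y ≈ 0# → y ≈ 0#
  x*y≈0⇒y≈0 {x} {y} x≉0 xy≈0 with x⁻¹ , xx⁻¹≈1 ← inverse x x≉0 = begin
    y              ≈⟨ *-identityˡ y ⟨
    1# * y         ≈⟨ *-congʳ xx⁻¹≈1 ⟨
    x * x⁻¹ * y    ≈⟨ *CS.xy∙z≈y∙xz x x⁻¹ y ⟩
    x⁻¹ * (x * y)  ≈⟨ *-congˡ xy≈0 ⟩
    x⁻¹ * 0#       ≈⟨ zeroʳ x⁻¹ ⟩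
    0#             ∎

  *-nonzero : ∀ {x y} → ¬ x ≈ 0# → ¬ y ≈ 0# → ¬ x * y ≈ 0#
  *-nonzero x≉0 y≉0 xy≈0 = y≉0 (x*y≈0⇒y≈0 x≉0 xy≈0)

  *-cancelˡ : ∀ {x y z} → ¬ x ≈ 0# → x * y ≈ x * z → y ≈ z
  *-cancelˡ {x} {y} {z} x≉0 xy≈xz = x-y≈0⇒x≈y y z
    (x*y≈0⇒y≈0 x≉0 (trans (*-distribˡ-- x y z) (x≈y⇒x-y≈0 xy≈xz)))

  private
    ^≈ : ∀ x n → x ^ n ≈ x E.^ n
    ^≈ x zero    = refl
    ^≈ x (suc n) = *-congˡ (^≈ x n)

  ^-congˡ : ∀ n {x y} → x ≈ y → x ^ n ≈ y ^ n
  ^-congˡ zero    x≈y = refl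
  ^-congˡ (suc n) x≈y = *-cong x≈y (^-congˡ n x≈y)

  ^-congʳ : ∀ x {m n} → m ≡ n → x ^ m ≈ x ^ n
  ^-congʳ x ≡.refl = refl

  ^-homo-* : ∀ x m n → x ^ (m ℕ.+ n) ≈ x ^ m * x ^ n
  ^-homo-* x m n =
    trans (^≈ x (m ℕ.+ n)) (trans (E.^-homo-* x m n) (sym (*-cong (^≈ x m) (^≈ x n))))

  ^-assocʳ : ∀ x m n → (x ^ m) ^ n ≈ x ^ (m ℕ.* n)
  ^-assocʳ x m n = begin
    (x ^ m) ^ n      ≈⟨ ^-congˡ n (^≈ x m) ⟩
    (x E.^ m) ^ n    ≈⟨ ^≈ (x E.^ m) n ⟩
    (x E.^ m) E.^ n  ≈⟨ E.^-assocʳ x m n ⟩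
    x E.^ (m ℕ.* n)  ≈⟨ ^≈ x (m ℕ.* n) ⟨
    x ^ (m ℕ.* n)    ∎

  ^-distrib-* : ∀ x y n → (x * y) ^ n ≈ x ^ n * y ^ n
  ^-distrib-* x y n =
    trans (^≈ (x * y) n) (trans (CE.^-distrib-* x y n) (sym (*-cong (^≈ x n) (^≈ y n))))

  1^n≈1 : ∀ n → 1# ^ n ≈ 1#
  1^n≈1 zero    = refl
  1^n≈1 (suc n) = trans (*-identityˡ _) (1^n≈1 n)

  0^[1+n]≈0 : ∀ n → 0# ^ suc n ≈ 0#
  0^[1+n]≈0 n = zeroˡ _

  ^-nonzero : ∀ n {x} → ¬ x ≈ 0# → ¬ x ^ n ≈ 0#
  ^-nonzero zero    x≉0 1≈0 = 0≉1 (sym 1≈0)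
  ^-nonzero (suc n) x≉0     = *-nonzero x≉0 (^-nonzero n x≉0)

  ∑-cong : ∀ r {f g : Fin r → Carrier} → (∀ i → f i ≈ g i) → ∑ r f ≈ ∑ r g
  ∑-cong zero    f≈g = refl
  ∑-cong (suc r) f≈g = +-cong (f≈g zero) (∑-cong r (f≈g ∘ suc))

  ∑-zero : ∀ r {f : Fin r → Carrier} → (∀ i → f i ≈ 0#) → ∑ r f ≈ 0#
  ∑-zero zero    f≈0 = refl
  ∑-zero (suc r) f≈0 = trans (+-cong (f≈0 zero) (∑-zero r (f≈0 ∘ suc))) (+-identityˡ 0#)

  ∑-distrib-+ : ∀ r (f g : Fin r → Carrier) → ∑ r (λ i → f i + g i) ≈ ∑ r f + ∑ r g
  ∑-distrib-+ zero    f g = sym (+-identityˡ 0#)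
  ∑-distrib-+ (suc r) f g = trans (+-congˡ (∑-distrib-+ r (f ∘ suc) (g ∘ suc))) (CS.interchange _ _ _ _)

  *-distribˡ-∑ : ∀ r a (f : Fin r → Carrier) → a * ∑ r f ≈ ∑ r (λ i → a * f i)
  *-distribˡ-∑ zero    a f = zeroʳ a
  *-distribˡ-∑ (suc r) a f = trans (distribˡ a _ _) (+-congˡ (*-distribˡ-∑ r a (f ∘ suc)))

  ∑-splitAt : ∀ m n (f : Fin m ⊎ Fin n → Carrier) →
              ∑ (m ℕ.+ n) (f ∘ Fin.splitAt m) ≈ ∑ m (f ∘ inj₁) + ∑ n (f ∘ inj₂)
  ∑-splitAt zero    n f = sym (+-identityˡ _)
  ∑-splitAt (suc m) n f = begin
    f (inj₁ zero) + ∑ (m ℕ.+ n) (λ i → f (Sum.map suc id (Fin.splitAt m i)))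
      ≈⟨ +-congˡ (∑-splitAt m n (λ s → f (Sum.map suc id s))) ⟩
    f (inj₁ zero) + (∑ m (λ i → f (inj₁ (suc i))) + ∑ n (f ∘ inj₂))
      ≈⟨ +-assoc _ _ _ ⟨
    f (inj₁ zero) + ∑ m (λ i → f (inj₁ (suc i))) + ∑ n (f ∘ inj₂) ∎

  comb : (r : ℕ) → (Fin r → Carrier) → (Fin r → Carrier) → Carrier
  comb r c v = ∑ r (λ i → c i * v i)

  comb-distribˡ-- : ∀ r c d v → comb r (λ i → c i - d i) v ≈ comb r c v - comb r d v
  comb-distribˡ-- zero    c d v = sym (-‿inverseʳ 0#)
  comb-distribˡ-- (suc r) c d v = begin
    (c zero - d zero) * v zero + comb r (λ i → c (suc i) - d (suc i)) (v ∘ suc)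
      ≈⟨ +-cong (*-distribʳ-- _ _ _) (comb-distribˡ-- r (c ∘ suc) (d ∘ suc) (v ∘ suc)) ⟩
    (c zero * v zero - d zero * v zero) + (comb r (c ∘ suc) (v ∘ suc) - comb r (d ∘ suc) (v ∘ suc))
      ≈⟨ -‿+-interchange _ _ _ _ ⟨
    comb (suc r) c v - comb (suc r) d v ∎

  comb-*ˡ : ∀ r a c v → a * comb r c v ≈ comb r (λ i → a * c i) v
  comb-*ˡ r a c v =
    trans (*-distribˡ-∑ r a _) (∑-cong r (λ i → sym (*-assoc a (c i) (v i))))

  comb-*ʳ : ∀ r a c v → a * comb r c v ≈ comb r c (λ i → a * v i)
  comb-*ʳ r a c v =
    trans (*-distribˡ-∑ r a _) (∑-cong r (λ i → *CS.x∙yz≈y∙xz a (c i) (v i)))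

  comb-distribʳ-+ : ∀ r c u v → comb r c (λ i → u i + v i) ≈ comb r c u + comb r c v
  comb-distribʳ-+ r c u v =
    trans (∑-cong r (λ i → distribˡ (c i) (u i) (v i))) (∑-distrib-+ r _ _)

  -- Additivity of a Frobenius map as a property of its exponent. It is closed under products, so
  -- one proof for the characteristic serves q, q^t, `γ` and `κ` alike.
  PreservesSums : ℕ → Set
  PreservesSums Q = ∀ x y → (x + y) ^ Q ≈ x ^ Q + y ^ Q

  PreservesSums-1 : PreservesSums 1
  PreservesSums-1 x y = trans (*-identityʳ _) (sym (+-cong (*-identityʳ x) (*-identityʳ y)))

  PreservesSums-* : ∀ {P Q} → PreservesSums P → PreservesSums Q → PreservesSums (P ℕ.* Q)
  PreservesSums-* {P} {Q} addP addQ x y = begin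
    (x + y) ^ (P ℕ.* Q)            ≈⟨ ^-assocʳ (x + y) P Q ⟨
    ((x + y) ^ P) ^ Q              ≈⟨ ^-congˡ Q (addP x y) ⟩
    (x ^ P + y ^ P) ^ Q            ≈⟨ addQ _ _ ⟩
    (x ^ P) ^ Q + (y ^ P) ^ Q      ≈⟨ +-cong (^-assocʳ x P Q) (^-assocʳ y P Q) ⟩
    x ^ (P ℕ.* Q) + y ^ (P ℕ.* Q)  ∎

  PreservesSums-^ : ∀ {P} → PreservesSums P → ∀ k → PreservesSums (P ℕ.^ k)
  PreservesSums-^ addP zero    = PreservesSums-1
  PreservesSums-^ {P} addP (suc k) = PreservesSums-* {P} {P ℕ.^ k} addP (PreservesSums-^ addP k)

  -- In the binomial expansion every coefficient but the two outer ones is a multiple of `p`, and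
  -- `p` annihilates the field.
  freshman : ∀ {p} → Prime p → p M.× 1# ≈ 0# → PreservesSums p
  freshman {suc p} pr p×1≈0 x y = begin
    (x + y) ^ suc p            ≈⟨ ^≈ (x + y) (suc p) ⟩
    (x + y) E.^ suc p          ≈⟨ B.theorem (suc p) x y ⟩
    B.binomialExpansion x y (suc p)  ≈⟨ S.sum-init-last {suc p} t ⟩
    (t zero + S.sum (λ i → t (inject₁ (suc i)))) + t (fromℕ (suc p))
      ≈⟨ +-cong (trans (+-congˡ (trans (S.sum-cong-≋ middle) (S.sum-replicate-zero p))) (+-identityʳ _)) last ⟩
    t zero + x ^ suc p         ≈⟨ +-congʳ first ⟩
    y ^ suc p + x ^ suc p      ≈⟨ +-comm _ _ ⟩
    x ^ suc p + y ^ suc p      ∎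
    where
    t : Fin (suc (suc p)) → Carrier
    t = B.binomialTerm x y (suc p)

    p∣c⇒c×z≈0 : ∀ {c} → suc p ∣ c → ∀ z → c M.× z ≈ 0#
    p∣c⇒c×z≈0 (divides d ≡.refl) z = begin
      (d ℕ.* suc p) M.× z         ≈⟨ M.×-congʳ (d ℕ.* suc p) (*-identityˡ z) ⟨
      (d ℕ.* suc p) M.× (1# * z)  ≈⟨ M.×-assoc-* (d ℕ.* suc p) 1# z ⟨
      (d ℕ.* suc p) M.× 1# * z    ≈⟨ *-congʳ (M.×1-homo-* d (suc p)) ⟩
      (d M.× 1#) * (suc p M.× 1#) * z  ≈⟨ *-congʳ (*-congˡ p×1≈0) ⟩
      (d M.× 1#) * 0# * z         ≈⟨ *-congʳ (zeroʳ _) ⟩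
      0# * z                      ≈⟨ zeroˡ z ⟩
      0#                          ∎

    first : t zero ≈ y ^ suc p
    first = begin
      1# * y E.^ suc p + 0#  ≈⟨ +-identityʳ _ ⟩
      1# * y E.^ suc p       ≈⟨ *-identityˡ _ ⟩
      y E.^ suc p            ≈⟨ ^≈ y (suc p) ⟨
      y ^ suc p              ∎

    last : t (fromℕ (suc p)) ≈ x ^ suc p
    last rewrite Fin.toℕ-fromℕ p | nCn≡1 (suc p) | ℕ.n∸n≡0 p = begin
      x E.^ suc p * 1# + 0#  ≈⟨ +-identityʳ _ ⟩
      x E.^ suc p * 1#       ≈⟨ *-identityʳ _ ⟩
      x E.^ suc p            ≈⟨ ^≈ x (suc p) ⟨
      x ^ suc p              ∎

    middle : ∀ i → t (inject₁ (suc i)) ≈ 0#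
    middle i = p∣c⇒c×z≈0
      (prime∣pC[1+k] pr (toℕ (inject₁ i)) (≡.subst (ℕ._< p) (≡.sym (Fin.toℕ-inject₁ i)) (Fin.toℕ<n i))) _

-- Counting decidable subsets of a finite set.

-- `u` lists the subset without repetition, so `a` is its cardinality.
Enumeration : ∀ {N} → (Fin N → Set) → ℕ → Set
Enumeration {N} P a = Σ (Fin a → Fin N) λ u →
  (∀ k l → u k ≡ u l → k ≡ l) × (∀ k → P (u k)) × (∀ i → P i → ∃[ k ] u k ≡ i)

abstract
  enumerate : ∀ {N} {P : Fin N → Set} → (∀ i → Dec (P i)) → ∃ (Enumeration P)
  enumerate {zero}  P? = 0 , (λ ()) , (λ ()) , (λ ()) , (λ ())
  enumerate {suc N} {P} P? with enumerate (P? ∘ suc) | P? zero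
  ... | a , u , u-inj , Pu , u-surj | no ¬P0 =
    a , suc ∘ u , (λ k l eq → u-inj k l (Fin.suc-injective eq)) , Pu , λ where
      zero    P0 → contradiction P0 ¬P0
      (suc i) Pi → let k , uk≡i = u-surj i Pi in k , ≡.cong suc uk≡i
  ... | a , u , u-inj , Pu , u-surj | yes P0 = suc a , u′ , u′-inj , Pu′ , u′-surj
    where
    u′ : Fin (suc a) → Fin (suc N)
    u′ zero    = zero
    u′ (suc k) = suc (u k)

    u′-inj : ∀ k l → u′ k ≡ u′ l → k ≡ l
    u′-inj zero    zero    eq = ≡.refl
    u′-inj (suc k) (suc l) eq = ≡.cong suc (u-inj k l (Fin.suc-injective eq))

    Pu′ : ∀ k → P (u′ k)
    Pu′ zero    = P0
    Pu′ (suc k) = Pu k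

    u′-surj : ∀ i → P i → ∃[ k ] u′ k ≡ i
    u′-surj zero    _  = zero , ≡.refl
    u′-surj (suc i) Pi = let k , uk≡i = u-surj i Pi in suc k , ≡.cong suc uk≡i

-- Each index is sent to its position in the list for its own side; `back` undoes this, so the map
-- into the disjoint sum is injective.
n≤a+b : ∀ {n a b} {P : Fin n → Set} → (∀ i → Dec (P i)) →
        Enumeration P a → Enumeration (¬_ ∘ P) b → n ℕ.≤ a ℕ.+ b
n≤a+b {n} {a} {b} P? (u , _ , _ , u-surj) (v , _ , _ , v-surj) =
  Fin.injective⇒≤ {f = Fin.join a b ∘ side} λ {i} {j} eq →
    side-inj i j (≡.trans (≡.sym (Fin.splitAt-join a b (side i)))
                   (≡.trans (≡.cong (Fin.splitAt a) eq) (Fin.splitAt-join a b (side j))))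
  where
  back : Fin a ⊎ Fin b → Fin n
  back = [ u , v ]′

  split : ∀ i → ∃[ s ] back s ≡ i
  split i with P? i
  ... | yes p = let k , eq = u-surj i p in inj₁ k , eq
  ... | no ¬p = let k , eq = v-surj i ¬p in inj₂ k , eq

  side : Fin n → Fin a ⊎ Fin b
  side = proj₁ ∘ split

  side-inj : ∀ i j → side i ≡ side j → i ≡ j
  side-inj i j eq =
    ≡.trans (≡.sym (proj₂ (split i))) (≡.trans (≡.cong back eq) (proj₂ (split j)))

-- For Q = `suc R` this is the divisibility of Q^(w+1) - 1 by Q - 1, with a positive quotient: the
-- shape in which `FixedField` takes the order of the field.
[1+R]^[1+w]-1 : ∀ R w → ∃[ M ] suc R ℕ.^ suc w ≡ suc (R ℕ.* suc M)
[1+R]^[1+w]-1 R zero = 0 , ≡.refl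
[1+R]^[1+w]-1 R (suc w) with M , eq ← [1+R]^[1+w]-1 R w =
  suc M ℕ.+ R ℕ.* suc M , ≡.trans (≡.cong (suc R ℕ.*_) eq) (expand R M)
  where
  expand : ∀ R M → suc R ℕ.* suc (R ℕ.* suc M) ≡ suc (R ℕ.* suc (suc M ℕ.+ R ℕ.* suc M))
  expand = solve-∀

2≤q^[1+u] : ∀ {q} → 2 ℕ.≤ q → ∀ u → 2 ℕ.≤ q ℕ.^ suc u
2≤q^[1+u] {q} 2≤q u = ℕ.*-mono-≤ 2≤q (ℕ.m^n>0 q ⦃ ℕ.>-nonZero (ℕ.<⇒≤ 2≤q) ⦄ u)

-- Polynomial functions and their roots.

module Polynomials (F : Field) where
  open Field F hiding (zero)
  open FieldTheory F
  open FieldProperties F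
  open Relation.Binary.Reasoning.Setoid setoid
  private
    module CS = Algebra.Properties.CommutativeSemigroup +-commutativeSemigroup
    module *CS = Algebra.Properties.CommutativeSemigroup *-commutativeSemigroup

  -- A Horner scheme c + x·g(x) of length `d` ending in 1. The degree belongs to the scheme: over a
  -- finite field the function alone does not determine it.
  Monic : ℕ → Map → Set
  Monic zero    f = ∀ x → f x ≈ 1#
  Monic (suc d) f = ∃[ c ] ∃[ g ] (Monic d g × (∀ x → f x ≈ c + x * g x))

  monic-x^ : ∀ m {d f} → Monic d f → Monic (m ℕ.+ d) (λ x → x ^ m * f x)
  monic-x^ zero {zero}  mf x = trans (*-identityˡ _) (mf x)
  monic-x^ zero {suc d} (c , g , mg , eq) = c , g , mg , λ x → trans (*-identityˡ _) (eq x)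
  monic-x^ (suc m) mf = 0# , _ , monic-x^ m mf , λ x → trans (*-assoc x _ _) (sym (+-identityˡ _))

  monic-+ : ∀ b {d f} → Monic (suc d) f → Monic (suc d) (λ x → b + f x)
  monic-+ b (c , g , mg , eq) = b + c , g , mg , λ x → trans (+-congˡ (eq x)) (sym (+-assoc b c _))

  x+[y-x]≈y : ∀ x y → x + (y - x) ≈ y
  x+[y-x]≈y x y = trans (CS.x∙yz≈y∙xz x y (- x)) (trans (+-congˡ (-‿inverseʳ x)) (+-identityʳ y))

  -- Synthetic division: writing the outer x of c + x·g(x) as r + (x - r) brings out the value at
  -- `r` and leaves a quotient that is again in Horner form.
  monic-divide : ∀ d f → Monic (suc d) f → ∀ r →
                 ∃[ g ] (Monic d g × (∀ x → f x ≈ f r + (x - r) * g x))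
  monic-divide zero f (c , g , g≈1 , eq) r = g , g≈1 , λ x → begin
    f x                              ≈⟨ eq x ⟩
    c + x * g x                      ≈⟨ +-congˡ (*-congʳ (x+[y-x]≈y r x)) ⟨
    c + (r + (x - r)) * g x          ≈⟨ +-congˡ (distribʳ _ _ _) ⟩
    c + (r * g x + (x - r) * g x)    ≈⟨ +-assoc _ _ _ ⟨
    (c + r * g x) + (x - r) * g x    ≈⟨ +-congʳ (+-congˡ (*-congˡ (trans (g≈1 x) (sym (g≈1 r))))) ⟩
    (c + r * g r) + (x - r) * g x    ≈⟨ +-congʳ (eq r) ⟨
    f r + (x - r) * g x              ∎
  monic-divide (suc d) f (c , g , mg , eq) r with h , mh , geq ← monic-divide d g mg r =
    (λ x → g r + x * h x) , (g r , h , mh , λ x → refl) , λ x → begin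
    f x                                                ≈⟨ eq x ⟩
    c + x * g x                                        ≈⟨ +-congˡ (*-congˡ (geq x)) ⟩
    c + x * (g r + (x - r) * h x)                      ≈⟨ +-congˡ (distribˡ _ _ _) ⟩
    c + (x * g r + x * ((x - r) * h x))
      ≈⟨ +-congˡ (+-cong (*-congʳ (sym (x+[y-x]≈y r x))) (*CS.x∙yz≈y∙xz x (x - r) (h x))) ⟩
    c + ((r + (x - r)) * g r + (x - r) * (x * h x))    ≈⟨ +-congˡ (+-congʳ (distribʳ _ _ _)) ⟩
    c + (r * g r + (x - r) * g r + (x - r) * (x * h x))
      ≈⟨ +-congˡ (+-assoc _ _ _) ⟩
    c + (r * g r + ((x - r) * g r + (x - r) * (x * h x)))
      ≈⟨ +-assoc _ _ _ ⟨
    (c + r * g r) + ((x - r) * g r + (x - r) * (x * h x))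
      ≈⟨ +-cong (sym (eq r)) (sym (distribˡ _ _ _)) ⟩
    f r + (x - r) * (g r + x * h x)                    ∎

  -- Divide by x - `v zero`: the other roots differ from `v zero`, so they are roots of the
  -- quotient, whose degree is one less.
  monic-roots : ∀ d f → Monic d f → ∀ {m} (v : Fin m → Carrier) →
                (∀ i j → v i ≈ v j → i ≡ j) → (∀ i → f (v i) ≈ 0#) → m ℕ.≤ d
  monic-roots d       f mf  {zero}  v v-inj fv≈0 = z≤n
  monic-roots zero    f f≈1 {suc m} v v-inj fv≈0 =
    contradiction (trans (sym (fv≈0 zero)) (f≈1 (v zero))) 0≉1
  monic-roots (suc d) f mf  {suc m} v v-inj fv≈0
    with g , mg , eq ← monic-divide d f mf (v zero) =
    s≤s (monic-roots d g mg (v ∘ suc) (λ i j → Fin.suc-injective ∘ v-inj (suc i) (suc j)) λ i →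
      x*y≈0⇒y≈0
        (λ vᵢ-v₀≈0 → contradiction (v-inj (suc i) zero (x-y≈0⇒x≈y _ _ vᵢ-v₀≈0)) λ ())
        (begin
          (v (suc i) - v zero) * g (v (suc i))             ≈⟨ +-identityˡ _ ⟨
          0# + (v (suc i) - v zero) * g (v (suc i))        ≈⟨ +-congʳ (fv≈0 zero) ⟨
          f (v zero) + (v (suc i) - v zero) * g (v (suc i)) ≈⟨ eq (v (suc i)) ⟨
          f (v (suc i))                                    ≈⟨ fv≈0 (suc i) ⟩
          0#                                               ∎))

  -- The sum 1 + y + ... + y^k. At y = x^(Q-1), with a suitable `k`, it is the cofactor of x^Q - x
  -- in x^N - x.
  geometric : ℕ → Carrier → Carrier
  geometric zero    y = 1#
  geometric (suc k) y = 1# + y * geometric k y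

  geometric-sum : ∀ k y → (y - 1#) * geometric k y ≈ y ^ suc k - 1#
  geometric-sum zero    y = trans (*-identityʳ _) (+-congʳ (sym (*-identityʳ y)))
  geometric-sum (suc k) y = begin
    (y - 1#) * (1# + y * geometric k y)
      ≈⟨ distribˡ _ _ _ ⟩
    (y - 1#) * 1# + (y - 1#) * (y * geometric k y)
      ≈⟨ +-cong (*-identityʳ _) (*CS.x∙yz≈y∙xz _ _ _) ⟩
    (y - 1#) + y * ((y - 1#) * geometric k y)
      ≈⟨ +-congˡ (*-congˡ (geometric-sum k y)) ⟩
    (y - 1#) + y * (y ^ suc k - 1#)
      ≈⟨ +-congˡ (trans (*-distribˡ-- _ _ _) (+-congˡ (-‿cong (*-identityʳ y)))) ⟩
    (y - 1#) + (y ^ suc (suc k) - y)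
      ≈⟨ +-comm _ _ ⟩
    (y ^ suc (suc k) - y) + (y - 1#)
      ≈⟨ +-assoc _ _ _ ⟩
    y ^ suc (suc k) + (- y + (y - 1#))
      ≈⟨ +-congˡ (+-assoc _ _ _) ⟨
    y ^ suc (suc k) + (- y + y - 1#)
      ≈⟨ +-congˡ (trans (+-congʳ (-‿inverseˡ y)) (+-identityˡ _)) ⟩
    y ^ suc (suc k) - 1# ∎

  monic-geometric : ∀ R k → Monic (k ℕ.* suc R) (λ x → geometric k (x ^ suc R))
  monic-geometric R zero    x = refl
  monic-geometric R (suc k) = monic-+ 1# (monic-x^ (suc R) (monic-geometric R k))

-- Finite fields: decidability and characteristic.

module FiniteField (F : Field) {N : ℕ} (card : FieldTheory.HasCard F N) where
  open Field F hiding (zero)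
  open FieldTheory F
  open FieldProperties F
  open Polynomials F
  open Relation.Binary.Reasoning.Setoid setoid
  private
    module M = Algebra.Properties.Semiring.Mult semiring
    module + = Algebra.Properties.CommutativeMonoid.Sum +-commutativeMonoid

  element : Fin N → Carrier
  element = proj₁ card

  element-injective : ∀ i j → element i ≈ element j → i ≡ j
  element-injective = proj₁ (proj₂ card)

  index : Carrier → Fin N
  index x = proj₁ (proj₂ (proj₂ card) x)

  element-index : ∀ x → element (index x) ≈ x
  element-index x = proj₂ (proj₂ (proj₂ card) x)

  index-cong : ∀ {x y} → x ≈ y → index x ≡ index y
  index-cong {x} {y} x≈y = element-injective _ _
    (trans (element-index x) (trans x≈y (sym (element-index y))))

  index-injective : ∀ {x y} → index x ≡ index y → x ≈ y
  index-injective {x} {y} eq =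
    trans (sym (element-index x)) (trans (≡⇒≈ (≡.cong element eq)) (element-index y))

  index-element : ∀ i → index (element i) ≡ i
  index-element i = element-injective _ _ (element-index (element i))

  abstract
    _≈?_ : ∀ x y → Dec (x ≈ y)
    x ≈? y = map′ index-injective index-cong (index x Fin.≟ index y)

    any? : {P : Carrier → Set} → (∀ {x y} → x ≈ y → P x → P y) → (∀ x → Dec (P x)) → Dec (∃ P)
    any? resp P? = map′ (λ (i , Pi) → element i , Pi)
                        (λ (x , Px) → index x , resp (sym (element-index x)) Px)
                        (Fin.any? (P? ∘ element))

    -- Coordinates are searched one at a time, so candidates have the form `cons x v`; `resp`
    -- carries the property between vectors that agree only pointwise.
    anyVector? : ∀ r {P : (Fin r → Carrier) → Set} → (∀ {u v} → (∀ i → u i ≈ v i) → P u → P v) →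
                 (∀ v → Dec (P v)) → Dec (∃ P)
    anyVector? zero    resp P? = map′ (λ P[] → _ , P[]) (λ (v , Pv) → resp (λ ()) Pv) (P? (λ ()))
    anyVector? (suc r) {P} resp P? =
      map′ (λ (x , v , Pxv) → cons x v , Pxv)
           (λ (v , Pv) → v zero , v ∘ suc , resp (λ { zero → refl ; (suc i) → refl }) Pv)
           (any? (λ x≈y (v , Pxv) → v , resp (λ { zero → x≈y ; (suc i) → refl }) Pxv)
                 (λ x → anyVector? r (λ u≈v → resp (λ { zero → refl ; (suc i) → u≈v i }))
                                     (P? ∘ cons x)))
      where
      cons : Carrier → (Fin r → Carrier) → Fin (suc r) → Carrier
      cons x v zero    = x
      cons x v (suc i) = v i

  bijection⇒permutation : (f g : Map) → (∀ {x y} → x ≈ y → f x ≈ f y) → (∀ {x y} → x ≈ y → g x ≈ g y) →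
                          (∀ x → f (g x) ≈ x) → (∀ x → g (f x) ≈ x) → Permutation N N
  bijection⇒permutation f g f-cong g-cong fg gf =
    permutation (index ∘ f ∘ element) (index ∘ g ∘ element)
      (λ i → ≡.trans (index-cong (trans (f-cong (element-index _)) (fg _))) (index-element i))
      (λ i → ≡.trans (index-cong (trans (g-cong (element-index _)) (gf _))) (index-element i))

  -- Translation by 1 permutes the field, so the sum of all elements is unchanged when 1 is added to
  -- each of its `N` terms.
  N×1≈0 : N M.× 1# ≈ 0#
  N×1≈0 = trans (sym (+.sum-replicate N)) (+-identityʳ-unique (+.sum element) _ (begin
    +.sum element + +.sum {N} (λ _ → 1#)   ≈⟨ +.∑-distrib-+ element (λ _ → 1#) ⟨
    +.sum (λ i → element i + 1#)           ≈⟨ +.sum-cong-≋ {N} {λ i → element (π ⟨$⟩ʳ i)} (λ i → element-index _) ⟨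
    +.sum (λ i → element (π ⟨$⟩ʳ i))       ≈⟨ +.sum-permute element π ⟨
    +.sum element                          ∎))
    where
    cancel : ∀ {a b} → a + b ≈ 0# → ∀ x → (x + a) + b ≈ x
    cancel a+b≈0 x = trans (+-assoc _ _ _) (trans (+-congˡ a+b≈0) (+-identityʳ x))

    π : Permutation N N
    π = bijection⇒permutation (_+ 1#) (_- 1#) +-congʳ +-congʳ
          (cancel (-‿inverseˡ 1#)) (cancel (-‿inverseʳ 1#))

  -- The k-th power of p·1 is N·1 = 0, and a field has no nilpotent elements other than 0.
  p×1≈0 : ∀ p k → N ≡ p ℕ.^ k → p M.× 1# ≈ 0#
  p×1≈0 p k N≡p^k with (p M.× 1#) ≈? 0#
  ... | yes p≈0 = p≈0
  ... | no  p≉0 = contradiction (begin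
    (p M.× 1#) ^ k       ≈⟨ homo k ⟨
    (p ℕ.^ k) M.× 1#     ≈⟨ M.×-congˡ N≡p^k ⟨
    N M.× 1#             ≈⟨ N×1≈0 ⟩
    0#                   ∎) (^-nonzero k p≉0)
    where
    homo : ∀ k → (p ℕ.^ k) M.× 1# ≈ (p M.× 1#) ^ k
    homo zero    = +-identityʳ 1#
    homo (suc k) = trans (M.×1-homo-* p (p ℕ.^ k)) (*-congˡ (homo k))

-- Fermat's theorem in a finite field.

module FiniteFieldFermat (F : Field) {M : ℕ} (card : FieldTheory.HasCard F (suc M)) where
  open Field F hiding (zero)
  open FieldTheory F
  open FieldProperties F
  open FiniteField F card
  open Relation.Binary.Reasoning.Setoid setoid
  private
    module * = Algebra.Properties.CommutativeMonoid.Sum *-commutativeMonoid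

  product-nonzero : ∀ {n} (f : Fin n → Carrier) → (∀ i → ¬ f i ≈ 0#) → ¬ *.sum f ≈ 0#
  product-nonzero {zero}  f f≉0 1≈0 = 0≉1 (sym 1≈0)
  product-nonzero {suc n} f f≉0     = *-nonzero (f≉0 zero) (product-nonzero (f ∘ suc) (f≉0 ∘ suc))

  -- Multiplication by x permutes the non-zero elements; 1 stands in for the zero
  -- element so that the product runs over all of F.
  fermat : ∀ x → ¬ x ≈ 0# → x ^ M ≈ 1#
  fermat x x≉0 with y , xy≈1 ← inverse x x≉0 = begin
    x ^ M                              ≈⟨ replicate M ⟨
    *.sum {M} (λ _ → x)                ≈⟨ *.sum-cong-≋ (λ k → h≢ (Fin.punchInᵢ≢i i₀ k)) ⟨
    *.sum (λ k → h (Fin.punchIn i₀ k)) ≈⟨ *-identityˡ _ ⟨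
    1# * *.sum (λ k → h (Fin.punchIn i₀ k)) ≈⟨ *-congʳ h≡ ⟨
    h i₀ * *.sum (λ k → h (Fin.punchIn i₀ k)) ≈⟨ *.sum-remove {i = i₀} h ⟨
    *.sum h                            ≈⟨ *-cancelˡ (product-nonzero f f≉0) (begin
      *.sum f * *.sum h                  ≈⟨ *-comm _ _ ⟩
      *.sum h * *.sum f                  ≈⟨ *.∑-distrib-+ h f ⟨
      *.sum (λ i → h i * f i)            ≈⟨ *.sum-cong-≋ fπ ⟨
      *.sum (λ i → f (π ⟨$⟩ʳ i))         ≈⟨ *.sum-permute f π ⟨
      *.sum f                            ≈⟨ *-identityʳ _ ⟨
      *.sum f * 1#                       ∎) ⟩
    1#                                 ∎
    where
    i₀ : Fin (suc M)
    i₀ = index 0#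

    f h : Fin (suc M) → Carrier
    f i with i Fin.≟ i₀
    ... | yes _ = 1#
    ... | no  _ = element i
    h i with i Fin.≟ i₀
    ... | yes _ = 1#
    ... | no  _ = x

    h≢ : ∀ {i} → i ≢ i₀ → h i ≈ x
    h≢ {i} i≢i₀ with i Fin.≟ i₀
    ... | yes i≡i₀ = contradiction i≡i₀ i≢i₀
    ... | no  _    = refl

    h≡ : h i₀ ≈ 1#
    h≡ with i₀ Fin.≟ i₀
    ... | yes _     = refl
    ... | no  i₀≢i₀ = contradiction ≡.refl i₀≢i₀

    element≈0⇒≡ : ∀ {i} → element i ≈ 0# → i ≡ i₀
    element≈0⇒≡ {i} eq = ≡.trans (≡.sym (index-element i)) (index-cong eq)

    f≉0 : ∀ i → ¬ f i ≈ 0#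
    f≉0 i with i Fin.≟ i₀
    ... | yes _    = λ 1≈0 → 0≉1 (sym 1≈0)
    ... | no  i≢i₀ = i≢i₀ ∘ element≈0⇒≡

    cancel : ∀ {a b} → a * b ≈ 1# → ∀ z → a * (b * z) ≈ z
    cancel ab≈1 z = trans (sym (*-assoc _ _ _)) (trans (*-congʳ ab≈1) (*-identityˡ z))

    π : Permutation (suc M) (suc M)
    π = bijection⇒permutation (x *_) (y *_) *-congˡ *-congˡ
          (cancel xy≈1) (cancel (trans (*-comm y x) xy≈1))

    fπ : ∀ i → f (π ⟨$⟩ʳ i) ≈ h i * f i
    fπ i with i Fin.≟ i₀ | index (x * element i) Fin.≟ i₀
    ... | yes i≡i₀ | yes _    = sym (*-identityˡ 1#)
    ... | no  i≢i₀ | no  _    = element-index _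
    ... | yes ≡.refl | no ≢i₀ =
      contradiction (index-cong (trans (*-congˡ (element-index 0#)) (zeroʳ x))) ≢i₀
    ... | no  i≢i₀ | yes ≡i₀  =
      contradiction (element≈0⇒≡ (x*y≈0⇒y≈0 x≉0 (index-injective ≡i₀))) i≢i₀

    replicate : ∀ n → *.sum {n} (λ _ → x) ≈ x ^ n
    replicate zero    = refl
    replicate (suc n) = *-congˡ (replicate n)

-- The equation x^Q = x has exactly Q solutions.

module FixedField (F : Field) (R M : ℕ)
  (card : FieldTheory.HasCard F (suc (suc R ℕ.* suc M))) where
  open Field F hiding (zero)
  open FieldTheory F
  open FieldProperties F
  open Polynomials F
  open FiniteField F card
  open FiniteFieldFermat F card
  open Relation.Binary.Reasoning.Setoid setoid

  private
    Q N : ℕ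
    Q = suc (suc R)
    N = suc (suc R ℕ.* suc M)

    Root NonRoot : Fin N → Set
    Root    i = InFq Q (element i)
    NonRoot i = ¬ InFq Q (element i)

    root? : ∀ i → Dec (Root i)
    root? i = (element i ^ Q) ≈? element i

    -- This is x^(Q-1) - 1; one more Horner step in `a≤Q` turns it into x^Q - x.
    monic-1+R : Monic (suc R) (λ x → - 1# + x * (x ^ R * 1#))
    monic-1+R = - 1# , _ , ≡.subst (λ d → Monic d (λ x → x ^ R * 1#)) (ℕ.+-identityʳ R)
                             (monic-x^ R {0} {λ _ → 1#} (λ _ → refl)) , λ x → refl

    a≤Q : ∀ {a} → Enumeration Root a → a ℕ.≤ Q
    a≤Q (u , u-inj , u∈ , _) = monic-roots Q (λ x → 0# + x * (- 1# + x * (x ^ R * 1#)))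
      (0# , _ , monic-1+R , λ x → refl)
      (element ∘ u)
      (λ k l eq → u-inj k l (element-injective _ _ eq))
      (λ k → root (u∈ k))
      where
      root : ∀ {x} → InFq Q x → 0# + x * (- 1# + x * (x ^ R * 1#)) ≈ 0#
      root {x} x∈ = begin
        0# + x * (- 1# + x * (x ^ R * 1#))  ≈⟨ +-identityˡ _ ⟩
        x * (- 1# + x * (x ^ R * 1#))       ≈⟨ *-congˡ (+-congˡ (*-congˡ (*-identityʳ _))) ⟩
        x * (- 1# + x ^ suc R)              ≈⟨ *-congˡ (+-comm _ _) ⟩
        x * (x ^ suc R - 1#)                ≈⟨ *-distribˡ-- _ _ _ ⟩
        x ^ Q - x * 1#                      ≈⟨ +-congˡ (-‿cong (*-identityʳ x)) ⟩
        x ^ Q - x                           ≈⟨ x≈y⇒x-y≈0 x∈ ⟩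
        0#                                  ∎

    -- If x is not fixed, then x ≠ 0 and y = x^(Q-1) differs from 1, while y^(M+1) = x^(N-1) = 1 by
    -- Fermat. Hence 1 + y + ... + y^M vanishes.
    b≤M*[1+R] : ∀ {b} → Enumeration NonRoot b → b ℕ.≤ M ℕ.* suc R
    b≤M*[1+R] (v , v-inj , v∉ , _) = monic-roots _ _ (monic-geometric R M)
      (element ∘ v)
      (λ k l eq → v-inj k l (element-injective _ _ eq))
      (λ k → root (v∉ k))
      where
      root : ∀ {x} → ¬ InFq Q x → geometric M (x ^ suc R) ≈ 0#
      root {x} x∉ = x*y≈0⇒y≈0
        (λ y-1≈0 → x∉ (trans (*-congˡ (x-y≈0⇒x≈y _ _ y-1≈0)) (*-identityʳ x)))
        (trans (geometric-sum M (x ^ suc R))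
          (x≈y⇒x-y≈0 (trans (^-assocʳ x (suc R) (suc M)) (fermat x x≉0))))
        where
        x≉0 : ¬ x ≈ 0#
        x≉0 x≈0 = x∉ (trans (^-congˡ Q x≈0) (trans (0^[1+n]≈0 (suc R)) (sym x≈0)))

    -- The order of the field is N = Q + M(Q-1), and at most M(Q-1) elements are not fixed.
    Q≤a : ∀ {a b} → Enumeration Root a → Enumeration NonRoot b → Q ℕ.≤ a
    Q≤a {a} roots nonroots = ℕ.+-cancelʳ-≤ (M ℕ.* suc R) Q a
      (≡.subst (ℕ._≤ a ℕ.+ M ℕ.* suc R) (count R M)
        (ℕ.≤-trans (n≤a+b root? roots nonroots) (ℕ.+-monoʳ-≤ a (b≤M*[1+R] nonroots))))
      where
      count : ∀ R M → suc (suc R ℕ.* suc M) ≡ suc (suc R) ℕ.+ M ℕ.* suc R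
      count = solve-∀

    rootEnumeration : Enumeration Root Q
    rootEnumeration =
      let a , roots = enumerate root?
          b , nonroots = enumerate (¬? ∘ root?)
      in ≡.subst (Enumeration Root) (ℕ.≤-antisym (a≤Q roots) (Q≤a roots nonroots)) roots

  abstract
    fixedField : Σ (Fin Q → Carrier) λ e →
      (∀ i j → e i ≈ e j → i ≡ j) × (∀ i → InFq Q (e i)) × (∀ x → InFq Q x → ∃[ i ] e i ≈ x)
    fixedField =
      let u , u-inj , u∈ , u-surj = rootEnumeration in
      element ∘ u ,
      (λ i j eq → u-inj i j (element-injective _ _ eq)) ,
      u∈ ,
      λ x x∈ →
        let k , uk≡ = u-surj (index x) (trans (^-congˡ Q (element-index x)) (trans x∈ (sym (element-index x))))
        in k , trans (≡⇒≈ (≡.cong element uk≡)) (element-index x)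

-- Comparing exponents and bounded searches.

^-cancelˡ-≤ : ∀ {q} → 2 ℕ.≤ q → ∀ {m n} → q ℕ.^ m ℕ.≤ q ℕ.^ n → m ℕ.≤ n
^-cancelˡ-≤ {q} 2≤q {m} {n} qᵐ≤qⁿ with m ℕ.≤? n
... | yes m≤n = m≤n
... | no  m≰n = contradiction qᵐ≤qⁿ (ℕ.<⇒≱ (ℕ.^-monoʳ-< q 2≤q (ℕ.≰⇒> m≰n)))

funToFin-cong : ∀ {m n} {f g : Fin m → Fin n} → (∀ i → f i ≡ g i) → Fin.funToFin f ≡ Fin.funToFin g
funToFin-cong {zero}  f≗g = ≡.refl
funToFin-cong {suc m} f≗g = ≡.cong₂ Fin.combine (f≗g zero) (funToFin-cong (f≗g ∘ suc))

-- A descent from `b`. With `A r` saying that `r` independent vectors exist, the place where `A`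
-- fails next is a dimension.
last-true : ∀ {A : ℕ → Set} → (∀ r → Dec (A r)) → A 0 → ∀ b → ¬ A (suc b) → ∃[ r ] (A r × ¬ A (suc r))
last-true A? A0 zero    ¬A1 = 0 , A0 , ¬A1
last-true A? A0 (suc b) ¬A with A? (suc b)
... | yes A[1+b]  = suc b , A[1+b] , ¬A
... | no  ¬A[1+b] = last-true A? A0 b ¬A[1+b]

least : ∀ {A : ℕ → Set} → (∀ d → Dec (A d)) → ∀ b → A b →
        ∃[ d ] (A d × d ℕ.≤ b × (∀ e → A e → d ℕ.≤ e))
least A? zero    A0 = 0 , A0 , z≤n , λ _ _ → z≤n
least {A} A? (suc b) Ab with A? 0
... | yes A0 = 0 , A0 , z≤n , λ _ _ → z≤n
... | no ¬A0 with d , Ad , d≤b , d-least ← least (A? ∘ suc) b Ab =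
  suc d , Ad , s≤s d≤b , λ { zero A0 → contradiction A0 ¬A0 ; (suc e) Ae → s≤s (d-least e Ae) }

-- Fixed points of an additive power map.

module FixedPoints (F : Field) (Q : ℕ) (^Q-+ : FieldProperties.PreservesSums F Q) where
  open Field F hiding (zero)
  open FieldTheory F
  open FieldProperties F
  open Relation.Binary.Reasoning.Setoid setoid

  0^Q≈0 : 0# ^ Q ≈ 0#
  0^Q≈0 = +-identityʳ-unique (0# ^ Q) (0# ^ Q)
    (trans (sym (^Q-+ 0# 0#)) (^-congˡ Q (+-identityˡ 0#)))

  ^Q-neg : ∀ x → (- x) ^ Q ≈ - (x ^ Q)
  ^Q-neg x = -‿unique (x ^ Q) ((- x) ^ Q)
    (trans (sym (^Q-+ x (- x))) (trans (^-congˡ Q (-‿inverseʳ x)) 0^Q≈0))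

  -- Semilinearity: coefficients are raised to the power as well, and only fixed ones come out
  -- unchanged.
  ^Q-comb : ∀ r c v → comb r c v ^ Q ≈ comb r (λ i → c i ^ Q) (λ i → v i ^ Q)
  ^Q-comb zero    c v = 0^Q≈0
  ^Q-comb (suc r) c v = trans (^Q-+ _ _)
    (+-cong (^-distrib-* _ _ Q) (^Q-comb r (c ∘ suc) (v ∘ suc)))

  InFq-resp : ∀ {x y} → x ≈ y → InFq Q x → InFq Q y
  InFq-resp x≈y x∈ = trans (^-congˡ Q (sym x≈y)) (trans x∈ x≈y)

  InFq-0 : InFq Q 0#
  InFq-0 = 0^Q≈0

  InFq-1 : InFq Q 1#
  InFq-1 = 1^n≈1 Q

  InFq-* : ∀ {x y} → InFq Q x → InFq Q y → InFq Q (x * y)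
  InFq-* {x} {y} x∈ y∈ = trans (^-distrib-* x y Q) (*-cong x∈ y∈)

  InFq-neg : ∀ {x} → InFq Q x → InFq Q (- x)
  InFq-neg {x} x∈ = trans (^Q-neg x) (-‿cong x∈)

  InFq-- : ∀ {x y} → InFq Q x → InFq Q y → InFq Q (x - y)
  InFq-- {x} {y} x∈ y∈ = trans (^Q-+ x (- y)) (+-cong x∈ (InFq-neg y∈))

  InFq-inverse : ∀ {x y} → ¬ x ≈ 0# → x * y ≈ 1# → InFq Q x → InFq Q y
  InFq-inverse {x} {y} x≉0 xy≈1 x∈ = *-cancelˡ x≉0 (begin
    x * y ^ Q      ≈⟨ *-congʳ x∈ ⟨
    x ^ Q * y ^ Q  ≈⟨ ^-distrib-* x y Q ⟨
    (x * y) ^ Q    ≈⟨ ^-congˡ Q xy≈1 ⟩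
    1# ^ Q         ≈⟨ InFq-1 ⟩
    1#             ≈⟨ xy≈1 ⟨
    x * y          ∎)

  InFq-^ : ∀ {x} k → InFq Q x → InFq Q (x ^ k)
  InFq-^ zero    x∈ = InFq-1
  InFq-^ (suc k) x∈ = InFq-* x∈ (InFq-^ k x∈)

  InFq⇒^Q^k≈ : ∀ {x} → InFq Q x → ∀ k → x ^ (Q ℕ.^ k) ≈ x
  InFq⇒^Q^k≈ {x} x∈ zero    = *-identityʳ x
  InFq⇒^Q^k≈ {x} x∈ (suc k) = trans (sym (^-assocʳ x Q (Q ℕ.^ k)))
    (trans (^-congˡ (Q ℕ.^ k) x∈) (InFq⇒^Q^k≈ x∈ k))

-- Linear algebra over the fixed field, by counting.

module LinearAlgebra (F : Field) {N : ℕ} (card : FieldTheory.HasCard F N)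
  (Q : ℕ) (^Q-+ : FieldProperties.PreservesSums F Q) where
  open Field F hiding (zero)
  open FieldTheory F
  open FieldProperties F
  open FiniteField F card
  open FixedPoints F Q ^Q-+
  open Relation.Binary.Reasoning.Setoid setoid
  private
    module CS = Algebra.Properties.CommutativeSemigroup +-commutativeSemigroup

  FixedFieldEnumeration : Set
  FixedFieldEnumeration = Σ (Fin Q → Carrier) λ e →
    (∀ i j → e i ≈ e j → i ≡ j) × (∀ i → InFq Q (e i)) × (∀ x → InFq Q x → ∃[ i ] e i ≈ x)

  -- Vectors are functions on `B`: over `⊤` they are field elements, over `Bool` they are the
  -- coefficient pairs (α, β) of codewords.
  Indep : {B : Set} (r : ℕ) → (Fin r → B → Carrier) → Set
  Indep r v = ∀ c → (∀ i → InFq Q (c i)) → (∀ b → comb r c (λ i → v i b) ≈ 0#) → ∀ i → c i ≈ 0#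

  -- The `Q ^ r` combinations are distinct, by independence applied to the difference of two
  -- coefficient vectors, and `ι` numbers them.
  indep-count : FixedFieldEnumeration → ∀ {B : Set} {m} (ι : (B → Carrier) → Fin m) →
                (∀ x y → ι x ≡ ι y → ∀ b → x b ≈ y b) →
                ∀ {r} (v : Fin r → B → Carrier) → Indep r v → Q ℕ.^ r ℕ.≤ m
  indep-count (e , e-inj , e∈ , _) {B} {m} ι ι-inj {r} v v-indep =
    Fin.injective⇒≤ {f = λ i → ι (vec i)} λ {i} {j} eq →
      ≡.trans (≡.sym (Fin.funToFin-finToFin {r} {Q} i))
        (≡.trans (funToFin-cong (coeff i j (ι-inj _ _ eq))) (Fin.funToFin-finToFin {r} {Q} j))
    where
    vec : Fin (Q ℕ.^ r) → B → Carrier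
    vec i b = comb r (e ∘ Fin.finToFun i) (λ k → v k b)

    coeff : ∀ i j → (∀ b → vec i b ≈ vec j b) → ∀ k → Fin.finToFun {Q} {r} i k ≡ Fin.finToFun j k
    coeff i j eq k = e-inj _ _ (x-y≈0⇒x≈y _ _
      (v-indep (λ k → e (Fin.finToFun i k) - e (Fin.finToFun j k)) (λ k → InFq-- (e∈ _) (e∈ _))
        (λ b → trans (comb-distribˡ-- r _ _ (λ k → v k b)) (x≈y⇒x-y≈0 (eq b))) k))

  indepElems-count : FixedFieldEnumeration → ∀ {r} v → IndepElems Q r v → Q ℕ.^ r ℕ.≤ N
  indepElems-count E v v-indep = indep-count E {⊤} (λ x → index (x tt))
    (λ _ _ eq _ → index-injective eq) (λ i _ → v i) (λ c c∈ eq → v-indep c c∈ (eq tt))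

  -- An element is recovered from its coefficients, so choosing coefficients embeds the field into
  -- the `Q ^ r` coefficient vectors.
  spanning-count : FixedFieldEnumeration → ∀ {r} v →
                   (∀ x → ∃[ c ] ((∀ i → InFq Q (c i)) × x ≈ comb r c v)) → N ℕ.≤ Q ℕ.^ r
  spanning-count (e , _ , _ , e-surj) {r} v span = Fin.injective⇒≤ {f = λ i → Fin.funToFin (κ i)} λ {i} {j} eq →
    element-injective _ _ (begin
      element i                  ≈⟨ value i ⟩
      comb r (e ∘ κ i) v         ≈⟨ ∑-cong r (λ k → *-congʳ (≡⇒≈ (≡.cong e (κ≗ i j eq k)))) ⟩
      comb r (e ∘ κ j) v         ≈⟨ value j ⟨
      element j                  ∎)
    where
    coeff : ∀ i → ∃[ c ] ((∀ k → InFq Q (c k)) × element i ≈ comb r c v)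
    coeff i = span (element i)

    κ : Fin N → Fin r → Fin Q
    κ i k = let c , c∈ , _ = coeff i in proj₁ (e-surj (c k) (c∈ k))

    value : ∀ i → element i ≈ comb r (e ∘ κ i) v
    value i = let c , c∈ , eq = coeff i in
      trans eq (∑-cong r (λ k → *-congʳ (sym (proj₂ (e-surj (c k) (c∈ k))))))

    κ≗ : ∀ i j → Fin.funToFin (κ i) ≡ Fin.funToFin (κ j) → ∀ k → κ i k ≡ κ j k
    κ≗ i j eq k = ≡.trans (≡.sym (Fin.finToFun-funToFin (κ i) k))
      (≡.trans (≡.cong (λ z → Fin.finToFun z k) eq) (Fin.finToFun-funToFin (κ j) k))

  indep-resp : ∀ {r u v} → (∀ i → u i ≈ v i) → IndepElems Q r u → IndepElems Q r v
  indep-resp {r} u≈v u-indep c c∈ eq =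
    u-indep c c∈ (trans (∑-cong r (λ i → *-congˡ (u≈v i))) eq)

  infixr 5 _∷_
  _∷_ : ∀ {A : Set} {r} → A → (Fin r → A) → Fin (suc r) → A
  (x ∷ v) zero    = x
  (x ∷ v) (suc i) = v i

  indep-tail : ∀ {r v} → IndepElems Q (suc r) v → IndepElems Q r (v ∘ suc)
  indep-tail {r} {v} v-indep c c∈ eq i =
    v-indep (0# ∷ c) (λ { zero → InFq-0 ; (suc i) → c∈ i })
      (trans (+-congʳ (zeroˡ _)) (trans (+-identityˡ _) eq)) (suc i)

  indep-head≉0 : ∀ {r v} → IndepElems Q (suc r) v → ¬ v zero ≈ 0#
  indep-head≉0 {r} {v} v-indep v₀≈0 = 0≉1 (sym (v-indep (1# ∷ λ _ → 0#)
    (λ { zero → InFq-1 ; (suc i) → InFq-0 })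
    (trans (+-cong (trans (*-congˡ v₀≈0) (zeroʳ 1#)) (∑-zero r (λ i → zeroˡ _))) (+-identityˡ 0#))
    zero))

  -- The failure of independence with its witness spelled out; a finite search decides it, and so
  -- decides independence.
  Dependent : (r : ℕ) → (Fin r → Carrier) → Set
  Dependent r v = ∃[ c ] ((∀ i → InFq Q (c i)) × comb r c v ≈ 0# × ∃[ i ] ¬ c i ≈ 0#)

  abstract
    dependent? : ∀ r v → Dec (Dependent r v)
    dependent? r v = anyVector? r
      (λ c≈d (c∈ , eq , i , cᵢ≉0) →
        (λ i → InFq-resp (c≈d i) (c∈ i)) ,
        trans (∑-cong r (λ i → *-congʳ (sym (c≈d i)))) eq ,
        i , λ dᵢ≈0 → cᵢ≉0 (trans (c≈d i) dᵢ≈0))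
      (λ c → Fin.all? (λ i → (c i ^ Q) ≈? c i) ×-dec (comb r c v ≈? 0#) ×-dec Fin.any? (λ i → ¬? (c i ≈? 0#)))

    indep? : ∀ r v → Dec (IndepElems Q r v)
    indep? r v = map′
      (λ ¬dep c c∈ eq i → decidable-stable (c i ≈? 0#) (λ cᵢ≉0 → ¬dep (c , c∈ , eq , i , cᵢ≉0)))
      (λ ind (c , c∈ , eq , i , cᵢ≉0) → cᵢ≉0 (ind c c∈ eq i))
      (¬? (dependent? r v))

    ¬indep⇒dependent : ∀ {r v} → ¬ IndepElems Q r v → Dependent r v
    ¬indep⇒dependent {r} {v} ¬ind = decidable-stable (dependent? r v) λ ¬dep →
      ¬ind λ c c∈ eq i → decidable-stable (c i ≈? 0#) (λ cᵢ≉0 → ¬dep (c , c∈ , eq , i , cᵢ≉0))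

  IndepIn : (Carrier → Set) → ℕ → Set
  IndepIn P r = ∃[ v ] ((∀ i → P (v i)) × IndepElems Q r v)

  module _ {P : Carrier → Set} (P-resp : ∀ {x y} → x ≈ y → P x → P y) (P? : ∀ x → Dec (P x)) where

    abstract
      indepIn? : ∀ r → Dec (IndepIn P r)
      indepIn? r = anyVector? r
        (λ u≈v (Pu , u-indep) → (λ i → P-resp (u≈v i) (Pu i)) , indep-resp u≈v u-indep)
        (λ v → Fin.all? (P? ∘ v) ×-dec indep? r v)

      maximalIndepIn : ∀ b → ¬ IndepIn P (suc b) → ∃[ r ] (IndepIn P r × ¬ IndepIn P (suc r))
      maximalIndepIn = last-true indepIn? ((λ ()) , (λ ()) , (λ _ _ _ ()))

  abstract
    -- By maximality `y ∷ v` satisfies a non-trivial relation. The coefficient of `y` cannot vanish,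
    -- since `v` is independent, so the relation can be solved for `y`.
    maximal⇒spanning : ∀ {P : Carrier → Set} {r v} → (∀ i → P (v i)) → IndepElems Q r v →
                       ¬ IndepIn P (suc r) →
                       ∀ y → P y → ∃[ c ] ((∀ i → InFq Q (c i)) × y ≈ comb r c v)
    maximal⇒spanning {P} {r} {v} Pv v-indep v-max y Py
      with c , c∈ , eq , i , cᵢ≉0 ← ¬indep⇒dependent {v = y ∷ v}
             (λ ind → v-max (y ∷ v , (λ { zero → Py ; (suc i) → Pv i }) , ind))
      with c zero ≈? 0#
    ... | yes c₀≈0 = contradiction (c≈0 i) cᵢ≉0
      where
      c≈0 : ∀ i → c i ≈ 0#
      c≈0 zero    = c₀≈0
      c≈0 (suc i) = v-indep (c ∘ suc) (c∈ ∘ suc)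
        (trans (sym (trans (+-congʳ (trans (*-congʳ c₀≈0) (zeroˡ y))) (+-identityˡ _))) eq) i
    ... | no c₀≉0 with d , c₀d≈1 ← inverse (c zero) c₀≉0 =
      (λ i → (- d) * c (suc i)) ,
      (λ i → InFq-* (InFq-neg (InFq-inverse c₀≉0 c₀d≈1 (c∈ zero))) (c∈ (suc i))) ,
      (begin
        y                                ≈⟨ *-identityˡ y ⟨
        1# * y                           ≈⟨ *-congʳ c₀d≈1 ⟨
        c zero * d * y                   ≈⟨ *-congʳ (*-comm _ _) ⟩
        d * c zero * y                   ≈⟨ *-assoc _ _ _ ⟩
        d * (c zero * y)                 ≈⟨ *-congˡ (-‿unique _ _ (trans (+-comm _ _) eq)) ⟩
        d * - comb r (c ∘ suc) v         ≈⟨ -‿distribʳ-* _ _ ⟨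
        - (d * comb r (c ∘ suc) v)       ≈⟨ -‿distribˡ-* _ _ ⟩
        - d * comb r (c ∘ suc) v         ≈⟨ comb-*ˡ r (- d) (c ∘ suc) v ⟩
        comb r (λ i → - d * c (suc i)) v ∎)

  -- Linearity is stated for whole combinations because it is applied to whole relations; f 0 ≈ 0
  -- and compatibility with differences are its cases of length 0 and 2.
  record Linear (f : Map) : Set where
    field
      cong     : ∀ {x y} → x ≈ y → f x ≈ f y
      map-comb : ∀ r c v → (∀ i → InFq Q (c i)) → f (comb r c v) ≈ comb r c (f ∘ v)

    map-0 : f 0# ≈ 0#
    map-0 = map-comb 0 (λ ()) (λ ()) (λ ())

    map-- : ∀ x y → f (x - y) ≈ f x - f y
    map-- x y = begin
      f (x - y)                ≈⟨ cong (expand x y) ⟩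
      f (comb 2 c (v x y))     ≈⟨ map-comb 2 c (v x y) (λ { zero → InFq-1 ; (suc zero) → InFq-neg InFq-1 }) ⟩
      comb 2 c (f ∘ v x y)     ≈⟨ expand (f x) (f y) ⟨
      f x - f y                ∎
      where
      c : Fin 2 → Carrier
      c = 1# ∷ λ _ → - 1#
      v : Carrier → Carrier → Fin 2 → Carrier
      v x y = x ∷ λ _ → y
      expand : ∀ x y → x - y ≈ 1# * x + (- 1# * y + 0#)
      expand x y = sym (+-cong (*-identityˡ x)
        (trans (+-identityʳ _) (trans (sym (-‿distribˡ-* 1# y)) (-‿cong (*-identityˡ y)))))

  module _ where
    open Linear

    linear-^ : ∀ {P} → PreservesSums P → (∀ {c} → InFq Q c → c ^ P ≈ c) → Linear (_^ P)
    linear-^ {P} ^P-+ fixed .cong = ^-congˡ P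
    linear-^ {P} ^P-+ fixed .map-comb r c v c∈ =
      trans (FixedPoints.^Q-comb F P ^P-+ r c v) (∑-cong r (λ i → *-congʳ (fixed (c∈ i))))

    linear-∘ : ∀ {f g} → Linear f → Linear g → Linear (f ∘ g)
    linear-∘ f-lin g-lin .cong = f-lin .cong ∘ g-lin .cong
    linear-∘ {f} {g} f-lin g-lin .map-comb r c v c∈ =
      trans (f-lin .cong (g-lin .map-comb r c v c∈)) (f-lin .map-comb r c (g ∘ v) c∈)

    linear-* : ∀ a {f} → Linear f → Linear (λ x → a * f x)
    linear-* a f-lin .cong = *-congˡ ∘ f-lin .cong
    linear-* a {f} f-lin .map-comb r c v c∈ =
      trans (*-congˡ (f-lin .map-comb r c v c∈)) (comb-*ʳ r a c (f ∘ v))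

    linear-+ : ∀ {f g} → Linear f → Linear g → Linear (λ x → f x + g x)
    linear-+ f-lin g-lin .cong x≈y = +-cong (f-lin .cong x≈y) (g-lin .cong x≈y)
    linear-+ {f} {g} f-lin g-lin .map-comb r c v c∈ =
      trans (+-cong (f-lin .map-comb r c v c∈) (g-lin .map-comb r c v c∈))
            (sym (comb-distribʳ-+ r c (f ∘ v) (g ∘ v)))

    linear-∑ : ∀ m {f : Fin m → Map} → (∀ i → Linear (f i)) → Linear (λ x → ∑ m (λ i → f i x))
    linear-∑ zero    f-lin .cong _ = refl
    linear-∑ zero    f-lin .map-comb r c v c∈ = sym (∑-zero r (λ i → zeroʳ (c i)))
    linear-∑ (suc m) f-lin = linear-+ (f-lin zero) (linear-∑ m (f-lin ∘ suc))

  InKernel : Map → Carrier → Set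
  InKernel f x = f x ≈ 0#

  module _ {f : Map} (f-linear : Linear f) where
    open Linear f-linear

    inKernel-resp : ∀ {x y} → x ≈ y → InKernel f x → InKernel f y
    inKernel-resp x≈y fx≈0 = trans (cong (sym x≈y)) fx≈0

    inImage-resp : ∀ {x y} → x ≈ y → InImage f x → InImage f y
    inImage-resp x≈y (u , fu≈x) = u , trans fu≈x x≈y

    inImage? : ∀ y → Dec (InImage f y)
    inImage? y = any? (λ x≈x′ fx≈y → trans (cong (sym x≈x′)) fx≈y) (λ x → f x ≈? y)

    -- Preimages of the image family together with the kernel family span: subtracting from x the
    -- combination of preimages with the same image leaves an element of the kernel.
    rank+nullity : FixedFieldEnumeration → ∀ {r k} →
                   IndepIn (InImage f) r → ¬ IndepIn (InImage f) (suc r) →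
                   IndepIn (InKernel f) k → ¬ IndepIn (InKernel f) (suc k) →
                   N ℕ.≤ Q ℕ.^ (r ℕ.+ k)
    rank+nullity E {r} {k} (v , v∈ , v-indep) v-max (w , w∈ , w-indep) w-max =
      spanning-count E ([ u , w ]′ ∘ Fin.splitAt r) span
      where
      u : Fin r → Carrier
      u i = proj₁ (v∈ i)

      span : ∀ x → ∃[ c ] ((∀ i → InFq Q (c i)) × x ≈ comb (r ℕ.+ k) c ([ u , w ]′ ∘ Fin.splitAt r))
      span x =
        let c , c∈ , fx≈cv = maximal⇒spanning {InImage f} v∈ v-indep v-max (f x) (x , refl)
            d , d∈ , x-cu≈dw = maximal⇒spanning {InKernel f} w∈ w-indep w-max (x - comb r c u)
                                 (residue x c c∈ fx≈cv)
        in [ c , d ]′ ∘ Fin.splitAt r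
         , (λ i → [_,_] {C = λ s → InFq Q ([ c , d ]′ s)} c∈ d∈ (Fin.splitAt r i))
         , decomposition x c d x-cu≈dw
        where
        residue : ∀ x c → (∀ i → InFq Q (c i)) → f x ≈ comb r c v → f (x - comb r c u) ≈ 0#
        residue x c c∈ fx≈cv = begin
          f (x - comb r c u)        ≈⟨ map-- _ _ ⟩
          f x - f (comb r c u)      ≈⟨ x≈y⇒x-y≈0 (trans fx≈cv (sym (trans (map-comb r c u c∈)
                                         (∑-cong r (λ i → *-congˡ (proj₂ (v∈ i))))))) ⟩
          0#                        ∎

        decomposition : ∀ x c d → x - comb r c u ≈ comb k d w →
          x ≈ comb (r ℕ.+ k) ([ c , d ]′ ∘ Fin.splitAt r) ([ u , w ]′ ∘ Fin.splitAt r)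
        decomposition x c d x-cu≈dw = begin
          x                              ≈⟨ +-identityʳ x ⟨
          x + 0#                         ≈⟨ +-congˡ (-‿inverseʳ _) ⟨
          x + (comb r c u - comb r c u)  ≈⟨ CS.x∙yz≈y∙xz _ _ _ ⟩
          comb r c u + (x - comb r c u)  ≈⟨ +-congˡ x-cu≈dw ⟩
          comb r c u + comb k d w        ≈⟨ ∑-splitAt r k (λ s → [ c , d ]′ s * [ u , w ]′ s) ⟨
          comb (r ℕ.+ k) ([ c , d ]′ ∘ Fin.splitAt r) ([ u , w ]′ ∘ Fin.splitAt r) ∎

    -- Applying `f` to a relation removes `w` and forces the coefficients of the preimages to
    -- vanish; then `w ≉ 0` settles the last one. Thus a non-zero kernel element keeps the rank
    -- below the dimension.
    indep-preimage : ∀ {r w} → ¬ w ≈ 0# → InKernel f w → IndepIn (InImage f) r →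
                     ∃[ u ] IndepElems Q (suc r) u
    indep-preimage {r} {w} w≉0 fw≈0 (v , v∈ , v-indep) = w ∷ (λ i → proj₁ (v∈ i)) , ind
      where
      u : Fin r → Carrier
      u i = proj₁ (v∈ i)

      ind : IndepElems Q (suc r) (w ∷ u)
      ind c c∈ eq = λ { zero → c₀≈0 ; (suc i) → tail≈0 i }
        where
        tail≈0 : ∀ i → c (suc i) ≈ 0#
        tail≈0 = v-indep (c ∘ suc) (c∈ ∘ suc) (begin
          comb r (c ∘ suc) v                    ≈⟨ ∑-cong r (λ i → *-congˡ (proj₂ (v∈ i))) ⟨
          comb r (c ∘ suc) (f ∘ u)              ≈⟨ +-identityˡ _ ⟨
          0# + comb r (c ∘ suc) (f ∘ u)         ≈⟨ +-congʳ (trans (*-congˡ fw≈0) (zeroʳ _)) ⟨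
          comb (suc r) c (f ∘ (w ∷ u))          ≈⟨ map-comb (suc r) c (w ∷ u) c∈ ⟨
          f (comb (suc r) c (w ∷ u))            ≈⟨ cong eq ⟩
          f 0#                                  ≈⟨ map-0 ⟩
          0#                                    ∎)

        c₀≈0 : c zero ≈ 0#
        c₀≈0 = x*y≈0⇒y≈0 w≉0 (begin
          w * c zero                            ≈⟨ *-comm _ _ ⟩
          c zero * w                            ≈⟨ +-identityʳ _ ⟨
          c zero * w + 0#                       ≈⟨ +-congˡ (∑-zero r (λ i → trans (*-congʳ (tail≈0 i)) (zeroˡ _))) ⟨
          comb (suc r) c (w ∷ u)                ≈⟨ eq ⟩
          0#                                    ∎)

fixedFieldEnumeration :
  (F : Field) {N : ℕ} (card : FieldTheory.HasCard F N) {Q w : ℕ}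
  (^Q-+ : FieldProperties.PreservesSums F Q) →
  2 ℕ.≤ Q → N ≡ Q ℕ.^ suc w → LinearAlgebra.FixedFieldEnumeration F card Q ^Q-+
fixedFieldEnumeration F card {suc (suc R)} {w} _ (s≤s (s≤s z≤n)) N≡ =
  let M , eq = [1+R]^[1+w]-1 (suc R) w in
  FixedField.fixedField F R M (≡.subst (FieldTheory.HasCard F) (≡.trans N≡ eq) card)

-- The fields 𝔽_q and K = 𝔽_{q^t} inside 𝔽_{q^n}.

module AlmostMRD
  (F : Field) (q : ℕ) (2≤q : 2 ℕ.≤ q) (^q-+ : FieldProperties.PreservesSums F q)
  (t t′ n : ℕ) (2≤t : 2 ℕ.≤ t) (2≤t′ : 2 ℕ.≤ t′) (n≡tt′ : n ≡ t ℕ.* t′)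
  (card : FieldTheory.HasCard F (q ℕ.^ n))
  (a : Fin t′ → Field.Carrier F)
  (g-injective : ∀ x y → Field._≈_ F (FieldTheory.gA F q t t′ a x) (FieldTheory.gA F q t t′ a y) → Field._≈_ F x y)
  (j : ℕ) (j⊥t : Coprime j t) (k : ℕ)
  where
  open Field F hiding (zero)
  open FieldTheory F
  open FieldProperties F
  open FiniteField F card
  open Relation.Binary.Reasoning.Setoid setoid

  private
    ^qⁱ-+ : ∀ i → PreservesSums (q ℕ.^ i)
    ^qⁱ-+ = PreservesSums-^ {q} ^q-+

    module Q-linear = LinearAlgebra F card q ^q-+
    module K-linear = LinearAlgebra F card (q ℕ.^ t) (^qⁱ-+ t)
    module Qᶠ = FixedPoints F q ^q-+
    module Kᶠ = FixedPoints F (q ℕ.^ t) (^qⁱ-+ t)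
    open Q-linear using (IndepIn; InKernel; Linear)

    γ κ : ℕ
    γ = q ℕ.^ j
    κ = q ℕ.^ (k ℕ.* t)

    g : Map
    g = gA q t t′ a

  t′<n : t′ ℕ.< n
  t′<n = ≡.subst (t′ ℕ.<_) (≡.trans (ℕ.*-comm t′ t) (≡.sym n≡tt′))
    (ℕ.m<m*n t′ t ⦃ ℕ.>-nonZero (ℕ.<⇒≤ 2≤t′) ⦄ 2≤t)

  q-enumeration : Q-linear.FixedFieldEnumeration
  -- The exponent is generalised so that it can be matched as a successor; `t′ < m` rules out 0.
  q-enumeration = enum n ≡.refl t′<n
    where
    enum : ∀ m → m ≡ n → t′ ℕ.< m → Q-linear.FixedFieldEnumeration
    enum (suc m) ≡.refl _ = fixedFieldEnumeration F card {q} {m} ^q-+ 2≤q ≡.refl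

  K-enumeration : K-linear.FixedFieldEnumeration
  K-enumeration = enum t t′ 2≤t 2≤t′ n≡tt′
    where
    enum : ∀ t t′ → 2 ℕ.≤ t → 2 ℕ.≤ t′ → n ≡ t ℕ.* t′ →
           LinearAlgebra.FixedFieldEnumeration F card (q ℕ.^ t) (^qⁱ-+ t)
    enum (suc t) (suc t′) _ _ n≡ = fixedFieldEnumeration F card {q ℕ.^ suc t} {t′} (^qⁱ-+ (suc t))
      (2≤q^[1+u] 2≤q t) (≡.trans (≡.cong (q ℕ.^_) n≡) (≡.sym (ℕ.^-*-assoc q (suc t) (suc t′))))

  indep≤n : ∀ {r} v → IndepElems q r v → r ℕ.≤ n
  indep≤n v v-indep = ^-cancelˡ-≤ 2≤q (Q-linear.indepElems-count q-enumeration v v-indep)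

  K-indep≤t′ : ∀ {r} v → IndepElems (q ℕ.^ t) r v → r ℕ.≤ t′
  K-indep≤t′ {r} v v-indep = ℕ.*-cancelˡ-≤ t ⦃ ℕ.>-nonZero (ℕ.<⇒≤ 2≤t) ⦄
    (^-cancelˡ-≤ 2≤q (≡.subst₂ ℕ._≤_ (ℕ.^-*-assoc q t r) (≡.cong (q ℕ.^_) n≡tt′)
      (K-linear.indepElems-count K-enumeration v v-indep)))

  -- The map is the i-fold iterate of x ↦ x^(q^t). This makes `g` and x ↦ x^κ linear over K.
  ^qⁱᵗ-fixes-K : ∀ i {c} → InFq (q ℕ.^ t) c → c ^ (q ℕ.^ (i ℕ.* t)) ≈ c
  ^qⁱᵗ-fixes-K i {c} c∈ = trans
    (^-congʳ c (≡.sym (≡.trans (ℕ.^-*-assoc q t i) (≡.cong (q ℕ.^_) (ℕ.*-comm t i)))))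
    (Kᶠ.InFq⇒^Q^k≈ c∈ i)

  InFq⇒InK : ∀ {c} → InFq q c → InFq (q ℕ.^ t) c
  InFq⇒InK c∈ = Qᶠ.InFq⇒^Q^k≈ c∈ t

  -- Raising to the power q^(x·l) fixes `c`. By the Bézout identity the same map is raising to
  -- q^(y·m), which also fixes `c`, followed by raising to q.
  bézout-fixed : ∀ {c} x y l m → 1 ℕ.+ y ℕ.* m ≡ x ℕ.* l →
                 InFq (q ℕ.^ l) c → InFq (q ℕ.^ m) c → InFq q c
  bézout-fixed {c} x y l m eq cˡ cᵐ = begin
    c ^ q                            ≈⟨ ^-congˡ q (power y m cᵐ) ⟨
    (c ^ (q ℕ.^ (y ℕ.* m))) ^ q      ≈⟨ ^-assocʳ c (q ℕ.^ (y ℕ.* m)) q ⟩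
    c ^ (q ℕ.^ (y ℕ.* m) ℕ.* q)      ≈⟨ ^-congʳ c (≡.trans (ℕ.*-comm _ q) (≡.cong (q ℕ.^_) eq)) ⟩
    c ^ (q ℕ.^ (x ℕ.* l))            ≈⟨ power x l cˡ ⟩
    c                                ∎
    where
    power : ∀ i m → InFq (q ℕ.^ m) c → c ^ (q ℕ.^ (i ℕ.* m)) ≈ c
    power i m cᵐ = trans
      (^-congʳ c (≡.sym (≡.trans (ℕ.^-*-assoc q m i) (≡.cong (q ℕ.^_) (ℕ.*-comm m i)))))
      (FixedPoints.InFq⇒^Q^k≈ F (q ℕ.^ m) (^qⁱ-+ m) cᵐ i)

  -- That γ generates the Galois group of K enters here, as coprimality of `j` and `t`. The sign in
  -- the Bézout identity decides which of the two exponents comes first.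
  K∩fix-γ⊆Fq : ∀ {c} → InFq (q ℕ.^ t) c → InFq γ c → InFq q c
  K∩fix-γ⊆Fq c∈K c∈γ with coprime-Bézout j⊥t
  ... | Bézout.+- x y eq = bézout-fixed x y j t eq c∈γ c∈K
  ... | Bézout.-+ x y eq = bézout-fixed y x t j eq c∈K c∈γ

  g-K-linear : K-linear.Linear g
  g-K-linear = K-linear.linear-∑ t′ (λ i → K-linear.linear-* (a i)
    (K-linear.linear-^ {q ℕ.^ (toℕ i ℕ.* t)} (^qⁱ-+ (toℕ i ℕ.* t)) (^qⁱᵗ-fixes-K (toℕ i))))

  g-linear : Linear g
  g-linear = Q-linear.linear-∑ t′ (λ i → Q-linear.linear-* (a i)
    (Q-linear.linear-^ {q ℕ.^ (toℕ i ℕ.* t)} (^qⁱ-+ (toℕ i ℕ.* t)) (^qⁱᵗ-fixes-K (toℕ i) ∘ InFq⇒InK)))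

  -- Codewords and relations in their kernels.

  codeword : Carrier → Carrier → Map
  codeword α β x = α * g (x ^ γ) + β * x ^ κ

  codeword-linear : ∀ α β → Linear (codeword α β)
  codeword-linear α β = Q-linear.linear-+
    (Q-linear.linear-* α (Q-linear.linear-∘ g-linear
      (Q-linear.linear-^ {γ} (^qⁱ-+ j) (λ c∈ → Qᶠ.InFq⇒^Q^k≈ c∈ j))))
    (Q-linear.linear-* β (Q-linear.linear-^ {κ} (^qⁱ-+ (k ℕ.* t)) (^qⁱᵗ-fixes-K k ∘ InFq⇒InK)))

  ^-zero⁻¹ : ∀ m {x} → x ^ m ≈ 0# → x ≈ 0#
  ^-zero⁻¹ m {x} xᵐ≈0 = decidable-stable (x ≈? 0#) (λ x≉0 → ^-nonzero m x≉0 xᵐ≈0)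

  -- Without the x^κ term only α·g(x^γ) remains; this is where the injectivity of `g` enters.
  kernel-β≈0 : ∀ {α β x} → ¬ α ≈ 0# → β ≈ 0# → codeword α β x ≈ 0# → x ≈ 0#
  kernel-β≈0 {α} {β} {x} α≉0 β≈0 fx≈0 = ^-zero⁻¹ γ (g-injective _ _ (begin
    g (x ^ γ)   ≈⟨ x*y≈0⇒y≈0 α≉0 (begin
      α * g (x ^ γ)             ≈⟨ +-identityʳ _ ⟨
      α * g (x ^ γ) + 0#        ≈⟨ +-congˡ (trans (*-congʳ β≈0) (zeroˡ _)) ⟨
      codeword α β x            ≈⟨ fx≈0 ⟩
      0#                        ∎) ⟩
    0#          ≈⟨ Q-linear.Linear.map-0 g-linear ⟨
    g 0#        ∎))

  -- Applying x ↦ g (x ^ γ) to a relation over K = 𝔽_{q^t} conjugates its coefficients by γ,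
  -- applying x ↦ x ^ κ leaves them alone, and on the kernel the two maps are proportional.
  kernel-relation : ∀ {α β} → ¬ β ≈ 0# → ∀ r λs x → (∀ i → InFq (q ℕ.^ t) (λs i)) →
                    (∀ i → codeword α β (x i) ≈ 0#) → comb r λs x ≈ 0# →
                    comb r (λ i → λs i ^ γ - λs i) x ≈ 0#
  kernel-relation {α} {β} β≉0 r λs x λs∈ x∈ker eq = ^-zero⁻¹ κ (begin
    comb r (λ i → λs i ^ γ - λs i) x ^ κ
      ≈⟨ ^κ-comb (λ i → λs i ^ γ - λs i) (λ i → Kᶠ.InFq-- (λs^γ∈ i) (λs∈ i)) ⟩
    comb r (λ i → λs i ^ γ - λs i) (λ i → x i ^ κ)
      ≈⟨ comb-distribˡ-- r _ _ _ ⟩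
    comb r (λ i → λs i ^ γ) (λ i → x i ^ κ) - comb r λs (λ i → x i ^ κ)
      ≈⟨ +-cong conjugate≈0 (-‿cong plain≈0) ⟩
    0# - 0#
      ≈⟨ -‿inverseʳ 0# ⟩
    0# ∎)
    where
    λs^γ∈ : ∀ i → InFq (q ℕ.^ t) (λs i ^ γ)
    λs^γ∈ i = Kᶠ.InFq-^ γ (λs∈ i)

    ^κ-comb : ∀ c → (∀ i → InFq (q ℕ.^ t) (c i)) → comb r c x ^ κ ≈ comb r c (λ i → x i ^ κ)
    ^κ-comb c c∈ = K-linear.Linear.map-comb
      (K-linear.linear-^ {κ} (^qⁱ-+ (k ℕ.* t)) (^qⁱᵗ-fixes-K k)) r c x c∈

    plain≈0 : comb r λs (λ i → x i ^ κ) ≈ 0#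
    plain≈0 = begin
      comb r λs (λ i → x i ^ κ)  ≈⟨ ^κ-comb λs λs∈ ⟨
      comb r λs x ^ κ            ≈⟨ ^-congˡ κ eq ⟩
      0# ^ κ                     ≈⟨ FixedPoints.0^Q≈0 F κ (^qⁱ-+ (k ℕ.* t)) ⟩
      0#                         ∎

    g-conjugate≈0 : comb r (λ i → λs i ^ γ) (λ i → g (x i ^ γ)) ≈ 0#
    g-conjugate≈0 = begin
      comb r (λ i → λs i ^ γ) (λ i → g (x i ^ γ))
        ≈⟨ K-linear.Linear.map-comb g-K-linear r _ (λ i → x i ^ γ) λs^γ∈ ⟨
      g (comb r (λ i → λs i ^ γ) (λ i → x i ^ γ))
        ≈⟨ K-linear.Linear.cong g-K-linear (FixedPoints.^Q-comb F γ (^qⁱ-+ j) r λs x) ⟨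
      g (comb r λs x ^ γ)
        ≈⟨ K-linear.Linear.cong g-K-linear
             (trans (^-congˡ γ eq) (FixedPoints.0^Q≈0 F γ (^qⁱ-+ j))) ⟩
      g 0#
        ≈⟨ K-linear.Linear.map-0 g-K-linear ⟩
      0# ∎

    conjugate≈0 : comb r (λ i → λs i ^ γ) (λ i → x i ^ κ) ≈ 0#
    conjugate≈0 = x*y≈0⇒y≈0 β≉0 (begin
      β * comb r (λ i → λs i ^ γ) (λ i → x i ^ κ)
        ≈⟨ +-identityˡ _ ⟨
      0# + β * comb r (λ i → λs i ^ γ) (λ i → x i ^ κ)
        ≈⟨ +-congʳ (trans (*-congˡ g-conjugate≈0) (zeroʳ α)) ⟨
      α * comb r (λ i → λs i ^ γ) (λ i → g (x i ^ γ)) + β * comb r (λ i → λs i ^ γ) (λ i → x i ^ κ)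
        ≈⟨ +-cong (comb-*ʳ r α _ _) (comb-*ʳ r β _ _) ⟩
      comb r (λ i → λs i ^ γ) (λ i → α * g (x i ^ γ)) + comb r (λ i → λs i ^ γ) (λ i → β * x i ^ κ)
        ≈⟨ comb-distribʳ-+ r _ _ _ ⟨
      comb r (λ i → λs i ^ γ) (λ i → codeword α β (x i))
        ≈⟨ ∑-zero r (λ i → trans (*-congˡ (x∈ker i)) (zeroʳ _)) ⟩
      0# ∎)

  kernel-indep⇒K-indep : ∀ {α β} → ¬ β ≈ 0# → ∀ r x → (∀ i → codeword α β (x i) ≈ 0#) →
                         IndepElems q r x → IndepElems (q ℕ.^ t) r x
  kernel-indep⇒K-indep β≉0 zero    x x∈ker x-indep c c∈ eq ()
  kernel-indep⇒K-indep {α} {β} β≉0 (suc r) x x∈ker x-indep c c∈ eq = c≈0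
    where
    tail-indep : IndepElems (q ℕ.^ t) r (x ∘ suc)
    tail-indep = kernel-indep⇒K-indep {α} {β} β≉0 r (x ∘ suc) (x∈ker ∘ suc)
      (Q-linear.indep-tail {v = x} x-indep)

    head≈0 : c zero ≈ 0#
    head≈0 = decidable-stable (c zero ≈? 0#) λ c₀≉0 →
      let d , c₀d≈1 = inverse (c zero) c₀≉0 in normalised c₀≉0 d c₀d≈1
      where
      normalised : ¬ c zero ≈ 0# → ∀ d → ¬ c zero * d ≈ 1#
      -- Once every `μ i` lies in 𝔽_q, independence over 𝔽_q applies to the relation itself and
      -- gives μ₀ = 0, against the normalisation μ₀ = 1.
      normalised c₀≉0 d c₀d≈1 = 0≉1 (trans (sym (x-indep μ μ∈Fq μx≈0 zero)) μ₀≈1)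
        where
        μ : Fin (suc r) → Carrier
        μ i = d * c i

        μ∈K : ∀ i → InFq (q ℕ.^ t) (μ i)
        μ∈K i = Kᶠ.InFq-* (Kᶠ.InFq-inverse c₀≉0 c₀d≈1 (c∈ zero)) (c∈ i)

        μ₀≈1 : μ zero ≈ 1#
        μ₀≈1 = trans (*-comm _ _) c₀d≈1

        μx≈0 : comb (suc r) μ x ≈ 0#
        μx≈0 = trans (sym (comb-*ˡ (suc r) d c x)) (trans (*-congˡ eq) (zeroʳ d))

        μ₀^γ-μ₀≈0 : μ zero ^ γ - μ zero ≈ 0#
        μ₀^γ-μ₀≈0 = x≈y⇒x-y≈0 (trans (^-congˡ γ μ₀≈1) (trans (1^n≈1 γ) (sym μ₀≈1)))

        μ^γ-μ≈0 : ∀ i → μ i ^ γ - μ i ≈ 0#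
        μ^γ-μ≈0 zero    = μ₀^γ-μ₀≈0
        μ^γ-μ≈0 (suc i) = tail-indep (λ i → μ (suc i) ^ γ - μ (suc i))
          (λ i → Kᶠ.InFq-- (Kᶠ.InFq-^ γ (μ∈K (suc i))) (μ∈K (suc i)))
          (trans (sym (trans (+-congʳ (trans (*-congʳ μ₀^γ-μ₀≈0) (zeroˡ _))) (+-identityˡ _)))
            (kernel-relation {α} {β} β≉0 (suc r) μ x μ∈K x∈ker μx≈0)) i

        μ∈Fq : ∀ i → InFq q (μ i)
        μ∈Fq i = K∩fix-γ⊆Fq (μ∈K i) (x-y≈0⇒x≈y _ _ (μ^γ-μ≈0 i))

    c≈0 : ∀ i → c i ≈ 0#
    c≈0 zero    = head≈0
    c≈0 (suc i) = tail-indep (c ∘ suc) (c∈ ∘ suc)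
      (trans (sym (trans (+-congʳ (trans (*-congʳ head≈0) (zeroˡ _))) (+-identityˡ _))) eq) i

  -- Nullity of codewords and uniqueness of their coefficients.

  NonZero₂ : Carrier → Carrier → Set
  NonZero₂ α β = ¬ (α ≈ 0# × β ≈ 0#)

  -- For β ≠ 0 the family stays independent over K. For β = 0 the kernel is trivial, while an
  -- independent family of positive length has a non-zero head.
  nullity≤t′ : ∀ {α β} → NonZero₂ α β → ∀ {r} → IndepIn (InKernel (codeword α β)) r → r ℕ.≤ t′
  nullity≤t′ {α} {β} αβ≉0 {r} (x , x∈ker , x-indep) with β ≈? 0#
  ... | no β≉0 = K-indep≤t′ x (kernel-indep⇒K-indep {α} {β} β≉0 r x x∈ker x-indep)
  ... | yes β≈0 with r
  ...   | zero  = z≤n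
  ...   | suc _ = contradiction (kernel-β≈0 (λ α≈0 → αβ≉0 (α≈0 , β≈0)) β≈0 (x∈ker zero))
                    (Q-linear.indep-head≉0 {v = x} x-indep)

  -- A maximal independent family of length r spans, so q^n ≤ q^r; independence gives the reverse
  -- inequality.
  basis : ∃[ w ] IndepElems q n w
  basis =
    let r , (w , _ , w-indep) , w-max = Q-linear.maximalIndepIn {λ _ → ⊤} _ (λ _ → yes _) n
          (λ (v , _ , v-indep) → ℕ.<-irrefl ≡.refl (indep≤n v v-indep))
        n≤r = ^-cancelˡ-≤ 2≤q (Q-linear.spanning-count q-enumeration w
                (λ x → Q-linear.maximal⇒spanning {λ _ → ⊤} _ w-indep w-max x _))
    in ≡.subst (λ m → ∃ (IndepElems q m)) (ℕ.≤-antisym (indep≤n w w-indep) n≤r) (w , w-indep)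

  -- Otherwise all n elements of a basis would lie in a kernel of dimension at most `t′ < n`.
  codeword≐0⇒zero : ∀ {α β} → (∀ x → codeword α β x ≈ 0#) → α ≈ 0# × β ≈ 0#
  codeword≐0⇒zero {α} {β} f≐0 = decidable-stable ((α ≈? 0#) ×-dec (β ≈? 0#)) λ αβ≉0 →
    let w , w-indep = basis in
    ℕ.<⇒≱ t′<n (nullity≤t′ αβ≉0 (w , (λ i → f≐0 (w i)) , w-indep))

  codeword-comb : ∀ r c α β x → comb r c (λ i → codeword (α i) (β i) x) ≈
                                codeword (comb r c α) (comb r c β) x
  codeword-comb r c α β x = trans (comb-distribʳ-+ r c _ _) (+-cong (pull α _) (pull β _))
    where
    pull : ∀ α z → comb r c (λ i → α i * z) ≈ comb r c α * z
    pull α z = begin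
      comb r c (λ i → α i * z)  ≈⟨ ∑-cong r (λ i → *-congˡ (*-comm (α i) z)) ⟩
      comb r c (λ i → z * α i)  ≈⟨ comb-*ʳ r z c α ⟨
      z * comb r c α            ≈⟨ *-comm _ _ ⟩
      comb r c α * z            ∎

  codeword-cong : ∀ {α α′ β β′} x → α ≈ α′ → β ≈ β′ → codeword α β x ≈ codeword α′ β′ x
  codeword-cong x α≈ β≈ = +-cong (*-congʳ α≈) (*-congʳ β≈)

  codeword-0 : ∀ {α β} x → α ≈ 0# → β ≈ 0# → codeword α β x ≈ 0#
  codeword-0 x α≈0 β≈0 = trans (codeword-cong x α≈0 β≈0)
    (trans (+-cong (zeroˡ _) (zeroˡ _)) (+-identityˡ 0#))

  codeword-- : ∀ α α′ β β′ x → codeword α β x - codeword α′ β′ x ≈ codeword (α - α′) (β - β′) x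
  codeword-- α α′ β β′ x = trans (-‿+-interchange _ _ _ _)
    (sym (+-cong (*-distribʳ-- _ _ _) (*-distribʳ-- _ _ _)))

  -- The dimension of the code.

  code : Code
  code = theCode q t t′ a j k

  private
    join-splitAt : ∀ {A : Set} (f : Fin (n ℕ.+ n) → A) i → f i ≡ f (Fin.join n n (Fin.splitAt n i))
    join-splitAt f i = ≡.cong f (≡.sym (Fin.join-splitAt n n i))

  -- For a basis w, the pairs (wᵢ, 0) and (0, wᵢ) give 2n independent codewords. Conversely,
  -- independent codewords have independent coefficient pairs, and there are only q^n · q^n pairs.
  code-dim : HasDim q code (n ℕ.+ n)
  code-dim = (h , (λ i → A (Fin.splitAt n i) , B (Fin.splitAt n i) , λ x → refl) , h-indep) , h-max
    where
    w : Fin n → Carrier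
    w = proj₁ basis

    A B : Fin n ⊎ Fin n → Carrier
    A = [ w , (λ _ → 0#) ]′
    B = [ (λ _ → 0#) , w ]′

    h : Fin (n ℕ.+ n) → Map
    h i = codeword (A (Fin.splitAt n i)) (B (Fin.splitAt n i))

    comb-⊎ : ∀ c (u : Fin n ⊎ Fin n → Carrier) → comb (n ℕ.+ n) c (u ∘ Fin.splitAt n) ≈
             comb n (c ∘ Fin.join n n ∘ inj₁) (u ∘ inj₁) + comb n (c ∘ Fin.join n n ∘ inj₂) (u ∘ inj₂)
    comb-⊎ c u = trans (∑-cong (n ℕ.+ n) (λ i → *-congʳ (≡⇒≈ (join-splitAt c i))))
      (∑-splitAt n n (λ s → c (Fin.join n n s) * u s))

    h-indep : IndepMaps q (n ℕ.+ n) h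
    h-indep c c∈ eq i = trans (≡⇒≈ (join-splitAt c i))
      ([_,_] {C = λ s → c (Fin.join n n s) ≈ 0#} left right (Fin.splitAt n i))
      where
      coefficients≈0 : comb (n ℕ.+ n) c (A ∘ Fin.splitAt n) ≈ 0# × comb (n ℕ.+ n) c (B ∘ Fin.splitAt n) ≈ 0#
      coefficients≈0 = codeword≐0⇒zero (λ x → trans (sym (codeword-comb (n ℕ.+ n) c _ _ x)) (eq x))

      left : ∀ i → c (Fin.join n n (inj₁ i)) ≈ 0#
      left = proj₂ basis (c ∘ Fin.join n n ∘ inj₁) (λ i → c∈ _) (begin
        comb n (c ∘ Fin.join n n ∘ inj₁) w       ≈⟨ +-identityʳ _ ⟨
        comb n (c ∘ Fin.join n n ∘ inj₁) w + 0#  ≈⟨ +-congˡ (∑-zero n (λ i → zeroʳ _)) ⟨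
        _                                        ≈⟨ comb-⊎ c A ⟨
        comb (n ℕ.+ n) c (A ∘ Fin.splitAt n)     ≈⟨ proj₁ coefficients≈0 ⟩
        0#                                       ∎)

      right : ∀ i → c (Fin.join n n (inj₂ i)) ≈ 0#
      right = proj₂ basis (c ∘ Fin.join n n ∘ inj₂) (λ i → c∈ _) (begin
        comb n (c ∘ Fin.join n n ∘ inj₂) w       ≈⟨ +-identityˡ _ ⟨
        0# + comb n (c ∘ Fin.join n n ∘ inj₂) w  ≈⟨ +-congʳ (∑-zero n (λ i → zeroʳ _)) ⟨
        _                                        ≈⟨ comb-⊎ c B ⟨
        comb (n ℕ.+ n) c (B ∘ Fin.splitAt n)     ≈⟨ proj₂ coefficients≈0 ⟩
        0#                                       ∎)

    h-max : (h : Fin (suc (n ℕ.+ n)) → Map) → (∀ i → code (h i)) → ¬ IndepMaps q (suc (n ℕ.+ n)) h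
    h-max h h∈ h-indep = ℕ.<-irrefl ≡.refl (^-cancelˡ-≤ 2≤q {suc (n ℕ.+ n)} {n ℕ.+ n}
      (≡.subst (q ℕ.^ suc (n ℕ.+ n) ℕ.≤_) (≡.sym (ℕ.^-distribˡ-+-* q n n))
        (Q-linear.indep-count q-enumeration
          (λ u → Fin.combine (index (u true)) (index (u false)))
          ι-injective coefficients coefficients-indep)))
      where
      coefficients : Fin (suc (n ℕ.+ n)) → Bool → Carrier
      coefficients i true  = proj₁ (h∈ i)
      coefficients i false = proj₁ (proj₂ (h∈ i))

      ι-injective : ∀ (u v : Bool → Carrier) →
        Fin.combine (index (u true)) (index (u false)) ≡ Fin.combine (index (v true)) (index (v false)) →
        ∀ b → u b ≈ v b
      ι-injective u v eq true  = index-injective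
        (Fin.combine-injectiveˡ (index (u true)) (index (u false)) (index (v true)) (index (v false)) eq)
      ι-injective u v eq false = index-injective
        (Fin.combine-injectiveʳ (index (u true)) (index (u false)) (index (v true)) (index (v false)) eq)

      coefficients-indep : Q-linear.Indep (suc (n ℕ.+ n)) coefficients
      coefficients-indep c c∈ eq = h-indep c c∈ λ x →
        trans (∑-cong (suc (n ℕ.+ n)) (λ i → *-congˡ {c i} (proj₂ (proj₂ (h∈ i)) x)))
          (trans (codeword-comb (suc (n ℕ.+ n)) c (λ i → coefficients i true) (λ i → coefficients i false) x)
            (codeword-0 x (eq true) (eq false)))

  -- The minimum distance.

  -- Being the absence of `suc d` independent values, this is decidable. The least `d` at which some
  -- pair satisfies it is the minimum distance, because differences of codewords are codewords.
  RankAtMost : ℕ → Carrier → Carrier → Set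
  RankAtMost d α β = NonZero₂ α β × ¬ IndepIn (InImage (codeword α β)) (suc d)

  image-resp : ∀ {f h} → f ≐ h → ∀ {y} → InImage f y → InImage h y
  image-resp f≐h (x , fx≈y) = x , trans (sym (f≐h x)) fx≈y

  indepIn-image-resp : ∀ {f h r} → f ≐ h → IndepIn (InImage f) r → IndepIn (InImage h) r
  indepIn-image-resp f≐h (v , v∈ , v-indep) = v , (λ i → image-resp f≐h (v∈ i)) , v-indep

  image? : ∀ α β r → Dec (IndepIn (InImage (codeword α β)) r)
  image? α β = Q-linear.indepIn? (Q-linear.inImage-resp (codeword-linear α β))
                                 (Q-linear.inImage? (codeword-linear α β))

  rankAtMost-resp : ∀ {d α α′ β β′} → α ≈ α′ → β ≈ β′ → RankAtMost d α β → RankAtMost d α′ β′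
  rankAtMost-resp α≈ β≈ (nz , small) =
    (λ (α′≈0 , β′≈0) → nz (trans α≈ α′≈0 , trans β≈ β′≈0)) ,
    small ∘ indepIn-image-resp (λ x → sym (codeword-cong x α≈ β≈))

  rankAtMost? : ∀ d → Dec (∃[ α ] ∃[ β ] RankAtMost d α β)
  rankAtMost? d = any? (λ α≈ (β , p) → β , rankAtMost-resp α≈ refl p)
    (λ α → any? (λ β≈ → rankAtMost-resp refl β≈)
      (λ β → ¬? ((α ≈? 0#) ×-dec (β ≈? 0#)) ×-dec ¬? (image? α β (suc d))))

  -- The codeword g(x^γ) − g(1) x^κ vanishes at 1.
  rankAtMost-n-1 : ∀ m → suc m ≡ n → ∃[ α ] ∃[ β ] RankAtMost m α β
  rankAtMost-n-1 m 1+m≡n = 1# , β , (λ (1≈0 , _) → 0≉1 (sym 1≈0)) , λ family →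
    let u , u-indep = Q-linear.indep-preimage (codeword-linear 1# β) (λ 1≈0 → 0≉1 (sym 1≈0)) 1∈ker family
    in ℕ.<-irrefl 1+m≡n (indep≤n u u-indep)
    where
    β : Carrier
    β = - g (1# ^ γ)

    1∈ker : codeword 1# β 1# ≈ 0#
    1∈ker = begin
      1# * g (1# ^ γ) + β * 1# ^ κ  ≈⟨ +-cong (*-identityˡ _) (trans (*-congˡ (1^n≈1 κ)) (*-identityʳ _)) ⟩
      g (1# ^ γ) - g (1# ^ γ)       ≈⟨ -‿inverseʳ _ ⟩
      0#                            ∎

  -- Rank-nullity with a maximal kernel family, whose length is at most `t′`.
  n≤rank+t′ : ∀ {α β d} → NonZero₂ α β → IndepIn (InImage (codeword α β)) d →
              ¬ IndepIn (InImage (codeword α β)) (suc d) → n ℕ.≤ d ℕ.+ t′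
  n≤rank+t′ {α} {β} {d} αβ≉0 v v-max =
    let l , w , w-max = Q-linear.maximalIndepIn (Q-linear.inKernel-resp f-linear) (λ x → codeword α β x ≈? 0#)
          t′ (λ family → ℕ.<-irrefl ≡.refl (nullity≤t′ αβ≉0 family))
    in ℕ.≤-trans (^-cancelˡ-≤ 2≤q (Q-linear.rank+nullity f-linear q-enumeration v v-max w w-max))
         (ℕ.+-monoʳ-≤ d (nullity≤t′ αβ≉0 w))
    where
    f-linear : Linear (codeword α β)
    f-linear = codeword-linear α β

  code-minDist : ∃[ d ] (HasMinDist q code d × d ℕ.≤ n ℕ.∸ 1 × n ℕ.≤ d ℕ.+ t′)
  code-minDist =
    let d , (α , β , αβ≉0 , small) , d≤n-1 , d-least = least rankAtMost? (n ℕ.∸ 1)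
          (rankAtMost-n-1 (n ℕ.∸ 1) (ℕ.m+[n∸m]≡n (ℕ.≤-trans (s≤s z≤n) t′<n)))
        family = attained d α β αβ≉0 d-least
    in d , (minimum d α β αβ≉0 family small , lower d d-least) , d≤n-1 , n≤rank+t′ αβ≉0 family small
    where
    Least : ℕ → Set
    Least d = ∀ e → (∃[ α ] ∃[ β ] RankAtMost e α β) → d ℕ.≤ e

    -- Minimality upgrades "at most d" to "exactly d": without d independent values the rank would
    -- be at most d - 1.
    attained : ∀ d α β → NonZero₂ α β → Least d → IndepIn (InImage (codeword α β)) d
    attained zero    α β αβ≉0 d-least = (λ ()) , (λ ()) , λ _ _ _ ()
    attained (suc e) α β αβ≉0 d-least = decidable-stable (image? α β (suc e)) λ ¬family →
      ℕ.<-irrefl ≡.refl (d-least e (α , β , αβ≉0 , ¬family))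

    minimum : ∀ d α β → NonZero₂ α β → IndepIn (InImage (codeword α β)) d →
              ¬ IndepIn (InImage (codeword α β)) (suc d) →
              ∃[ A ] ∃[ B ] (code A × code B × ¬ (A ≐ B) × HasRank q (A ⊖ B) d)
    minimum d α β αβ≉0 family small =
      codeword α β , codeword 0# 0# , (α , β , λ x → refl) , (0# , 0# , λ x → refl) ,
      (λ f≐0 → αβ≉0 (codeword≐0⇒zero (λ x → trans (f≐0 x) (codeword-0 x refl refl)))) ,
      indepIn-image-resp (λ x → sym (f-0≐f x)) family ,
      λ w w∈ w-indep → small (indepIn-image-resp f-0≐f (w , w∈ , w-indep))
      where
      f-0≐f : (codeword α β ⊖ codeword 0# 0#) ≐ codeword α β
      f-0≐f x = trans (+-congˡ (trans (-‿cong (codeword-0 x refl refl)) -0#≈0#)) (+-identityʳ _)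

    -- A - B is the codeword of the difference of the two pairs, which is non-zero because A and B
    -- differ; so it takes part in the search for the least rank.
    lower : ∀ d → Least d → ∀ A B → code A → code B → ¬ (A ≐ B) → ∀ r → HasRank q (A ⊖ B) r → d ℕ.≤ r
    lower d d-least A B (α , β , A≐) (α′ , β′ , B≐) A≭B r (_ , A-B-max) =
      d-least r (α - α′ , β - β′ ,
        (λ (α-α′≈0 , β-β′≈0) → A≭B λ x → x-y≈0⇒x≈y _ _
          (trans (A-B≐ x) (codeword-0 x α-α′≈0 β-β′≈0))) ,
        λ family → let w , w∈ , w-indep = indepIn-image-resp (λ x → sym (A-B≐ x)) family
                   in A-B-max w w∈ w-indep)
      where
      A-B≐ : (A ⊖ B) ≐ codeword (α - α′) (β - β′)
      A-B≐ x = trans (+-cong (A≐ x) (-‿cong (B≐ x))) (codeword-- α α′ β β′ x)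

  -- The Singleton-like bound and the defect of the code.

  -- At d = n - 1 the bound n(n - d + 1) is exactly 2n, and at d = n it is only n.
  dStar : IsDStar n (n ℕ.+ n) (n ℕ.∸ 1)
  dStar = bound n (ℕ.≤-trans (s≤s 2≤t′) t′<n)
    where
    bound : ∀ n → 3 ℕ.≤ n → IsDStar n (n ℕ.+ n) (n ℕ.∸ 1)
    bound (suc m) (s≤s 2≤m) =
      (ℕ.<⇒≤ 2≤m , ℕ.n≤1+n m , ℕ.≤-reflexive size) , maximal
      where
      size : suc m ℕ.+ suc m ≡ suc m ℕ.* (suc m ℕ.∸ m ℕ.+ 1)
      size = ≡.trans (≡.cong (suc m ℕ.+_) (≡.sym (ℕ.+-identityʳ (suc m))))
        (≡.trans (ℕ.*-comm 2 (suc m)) (≡.cong (λ z → suc m ℕ.* (z ℕ.+ 1)) (≡.sym (ℕ.m+n∸n≡m 1 m))))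

      maximal : ∀ e → 1 ℕ.≤ e → e ℕ.≤ suc m → suc m ℕ.+ suc m ℕ.≤ suc m ℕ.* (suc m ℕ.∸ e ℕ.+ 1) → e ℕ.≤ m
      maximal e _ e≤1+m size≤ with e ℕ.≤? m
      ... | yes e≤m = e≤m
      ... | no  e≰m with ≡.refl ← ℕ.≤-antisym e≤1+m (ℕ.≰⇒> e≰m) =
        contradiction (≡.subst (suc m ℕ.+ suc m ℕ.≤_)
            (≡.trans (≡.cong (λ z → suc m ℕ.* (z ℕ.+ 1)) (ℕ.n∸n≡0 (suc m))) (ℕ.*-identityʳ (suc m))) size≤)
          (ℕ.<⇒≱ (ℕ.m<m+n (suc m) (s≤s z≤n)))

  almostMRD : ∃[ s ] (IsAlmostMRD q n code s × s ℕ.≤ t′ ℕ.∸ 1)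
  almostMRD =
    let d , minDist , d≤n-1 , n≤d+t′ = code-minDist in
    -- The defect d* - d; the truncated subtraction is exact because d ≤ n - 1, and n - d ≤ t′
    -- bounds it by t′ - 1.
    n ℕ.∸ 1 ℕ.∸ d ,
    (n ℕ.+ n , d , n ℕ.∸ 1 , code-dim , minDist , dStar , ≡.sym (ℕ.m+[n∸m]≡n d≤n-1)) ,
    ≡.subst (ℕ._≤ t′ ℕ.∸ 1) (exchange n d) (ℕ.∸-monoˡ-≤ 1 (ℕ.m≤n+o⇒m∸n≤o n d n≤d+t′))
    where
    exchange : ∀ n d → n ℕ.∸ d ℕ.∸ 1 ≡ n ℕ.∸ 1 ℕ.∸ d
    exchange n d = ≡.trans (ℕ.∸-+-assoc n d 1) (≡.trans (≡.cong (n ℕ.∸_) (ℕ.+-comm d 1)) (≡.sym (ℕ.∸-+-assoc n 1 d)))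

-- Prime powers.

2≤primePower : ∀ {q} → IsPrimePower q → 2 ℕ.≤ q
2≤primePower (p , suc m , p-prime , _ , ≡.refl) =
  2≤q^[1+u] (ℕ.nonTrivial⇒n>1 p ⦃ prime⇒nonTrivial p-prime ⦄) m

-- With q = p^m the order of the field is p^(m·n), so p·1 = 0; the additive p-th power map is then
-- iterated m times.
primePower-preservesSums : ∀ {q} → IsPrimePower q → ∀ n (F : Field) →
  FieldTheory.HasCard F (q ℕ.^ n) → FieldProperties.PreservesSums F q
primePower-preservesSums (p , m , p-prime , _ , ≡.refl) n F card =
  FieldProperties.PreservesSums-^ F {p} (FieldProperties.freshman F p-prime
    (FiniteField.p×1≈0 F card p (m ℕ.* n) (ℕ.^-*-assoc p m n))) m

open import Data.Nat using (ℕ; _≤_; _*_; _∸_)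

theorem3p2 : (q : ℕ) → IsPrimePower q → (t t' n : ℕ) → 2 ≤ t → 2 ≤ t' → n ≡ t * t' →
    (F : Field) → FieldTheory.HasCard F (q Data.Nat.^ n) →
    (a : Fin t' → Field.Carrier F) → FieldTheory.Bijective F (FieldTheory.gA F q t t' a) →
    (j : ℕ) → Coprime j t → (k : ℕ) →
    ∃[ s ] (FieldTheory.IsAlmostMRD F q n (FieldTheory.theCode F q t t' a j k) s × s ≤ t' ∸ 1)
theorem3p2 q q-primePower t t' n 2≤t 2≤t' n≡tt' F card a (g-injective , _) j j⊥t k =
  AlmostMRD.almostMRD F q (2≤primePower q-primePower) (primePower-preservesSums q-primePower n F card)
    t t' n 2≤t 2≤t' n≡tt' card a g-injective j j⊥t k
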